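{- For every integer $k\ge 1$ there is a constant $c_k>0$ such that for every integer $n\ge 1$ there exists an $n$-point metric space $(X,d_X)$ with the following property: if $\mathcal{T}=\{T_1,\ldots,T_k\}$ is any $(\alpha,k)$-tree cover of $(X,d_X)$, then $\alpha\ge c_k\cdot n^{\frac{1}{2^{k-1}}}$. In other words, any size-$k$ tree cover of this metric has stretch $\Omega_k\big(n^{\frac{1}{2^{k-1}}}\big)$.
   Context: A tree on a finite set $X$ is a tree with vertex set $X$ whose edges carry positive real weights; $\mathrm{dist}_T(x,y)$ denotes the weighted shortest-path distance in $T$. Given a metric space $(X,d_X)$ with $|X|=n$, an $(\alpha,k)$-tree cover is a collection $\mathcal{T}=\{T_1,\ldots,T_k\}$ of $k$ edge-weighted trees on $X$ such that for every pair $x,y\in X$: (1) for each $1\le i\le k$, $\mathrm{dist}_{T_i}(x,y)\ge d_X(x,y)$ (each $T_i$ is a dominating tree); and (2) there exists $1\le i\le k$ with $\mathrm{dist}_{T_i}(x,y)\le \alpha\cdot d_X(x,y)$. The integer $k$ is the size and $\alpha\ge 1$ the stretch (distortion) of the tree cover.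
   Formalization: The edge weights of the trees in the cover and the stretch α are rational numbers instead of real numbers; the metric and the constant c_k are also found rational, and the bound is stated with both sides raised to the power 2^(k-1). -}

module Defs where

open import Data.Nat as ℕ using (ℕ; zero; suc)
open import Data.Integer using (+_)
open import Data.Fin using (Fin)
open import Data.Product using (_×_; _,_; Σ; ∃)
open import Data.List using (List; length)
open import Data.List.Membership.Propositional using (_∈_)
open import Data.List.Relation.Unary.All using (All)
open import Data.Rational using (ℚ; 0ℚ; 1ℚ; _+_; _*_; _≤_; _<_; _/_)
open import Relation.Binary.PropositionalEquality using (_≡_)
open import Relation.Nullary using (¬_)

ℕ→ℚ : ℕ → ℚ
ℕ→ℚ m = + m / 1

_^ℚ_ : ℚ → ℕ → ℚ
q ^ℚ zero  = 1ℚ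
q ^ℚ suc m = q * (q ^ℚ m)

record Metric (n : ℕ) : Set where
  field
    d        : Fin n → Fin n → ℚ
    d-self   : ∀ x → d x x ≡ 0ℚ
    d-pos    : ∀ x y → ¬ (x ≡ y) → 0ℚ < d x y
    d-sym    : ∀ x y → d x y ≡ d y x
    d-tri    : ∀ x y z → d x z ≤ d x y + d y z

Edge : ℕ → Set
Edge n = Fin n × Fin n × ℚ

data Walk {n : ℕ} (E : List (Edge n)) : Fin n → Fin n → ℚ → Set where
  stay : ∀ {x} → Walk E x x 0ℚ
  fwd  : ∀ {x y z w v} → (x , y , w) ∈ E → Walk E y z v → Walk E x z (w + v)
  bwd  : ∀ {x y z w v} → (y , x , w) ∈ E → Walk E y z v → Walk E x z (w + v)

record Tree (n : ℕ) : Set where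
  field
    edges     : List (Edge n)
    pos       : All (λ e → 0ℚ < Data.Product.proj₂ (Data.Product.proj₂ e)) edges
    size      : length edges ≡ n ℕ.∸ 1
    connected : ∀ x y → Σ ℚ (λ w → Walk edges x y w)

open Tree public

-- dist_T(x,y) ≥ r  (every walk from x to y has weight ≥ r; dist_T is the min)
distT≥ : ∀ {n} → Tree n → Fin n → Fin n → ℚ → Set
distT≥ T x y r = ∀ w → Walk (edges T) x y w → r ≤ w

distT≤ : ∀ {n} → Tree n → Fin n → Fin n → ℚ → Set
distT≤ T x y r = ∃ λ w → Walk (edges T) x y w × w ≤ r

IsTreeCover : ∀ {n k} → Metric n → ℚ → (Fin k → Tree n) → Set
IsTreeCover {n} {k} M α Ts =
  1ℚ ≤ α ×
  (∀ (i : Fin k) x y → distT≥ (Ts i) x y (Metric.d M x y)) ×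
  (∀ x y → ∃ λ (i : Fin k) → distT≤ (Ts i) x y (α * Metric.d M x y))

{-# OPTIONS --safe #-}

-- Let D = 2^(k-1). The hard metric is a D-dimensional torus with the maximum norm, whose circles are
-- boundaries of squares of side L, so that n is about (4L)^D; surplus points are doubled up.
--
-- If α < L, the pairs that are short in one of the trees never wind around the torus: crossing numbers
-- along the edges of a tree are the coboundary of a potential. Lifting the vertices of the torus to its
-- 2^D-fold cover, the k potentials give every vertex v of the cover a word P v of k letters in (ℤ/2)^D,
-- equivariant under the deck group, such that the words of two vertices of one unit cube agree
-- somewhere ("meet").
--
-- For a face F of a cube let F⊥ be the set of words meeting all P v, v ∈ F. No nonzero deck
-- transformation fixes F⊥, so a canonical element of its orbit yields a twisted periodic labelling of
-- the faces by (ℤ/2)^D. A parity count gives a flag F₀ ⊂ … ⊂ F_D along which the r-th label bit changes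
-- at step r; hence the F_r⊥ decrease strictly, and there are words y₀, …, y_D meeting each other and
-- words w₀, …, w_D such that w_j meets all y_i with i < j but not y_j. Viewing a word as the pure tensor
-- ⊗ (1, xᵢ) in (ℚ²)^{⊗k}, meeting is orthogonality for a nondegenerate form, so the y's are linearly
-- independent and span a totally isotropic subspace: D + 1 ≤ 2^(k-1), a contradiction.
module Submission where

open import Defs
open import Data.Nat as ℕ using (ℕ; zero; suc; _≥_; _∸_; _^_; _⊔_; ∣_-_∣; z≤n; s≤s)
open import Data.Nat.GeneralisedArithmetic using (fold; iterate; fold-+; iterate-is-fold)
import Data.Nat.Coprimality as Coprimality
import Data.Nat.Properties as ℕₚ
open import Data.Integer as ℤ using (ℤ; 0ℤ; 1ℤ; +_; +≤+; +<+)
import Data.Integer.Properties as ℤₚ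
open import Data.Integer.Tactic.RingSolver using (solve-∀)
open import Data.Rational using (ℚ; 0ℚ; 1ℚ; mkℚ; _+_; _*_; _≤_; _<_; _/_; *≤*; *<*; nonNegative)
import Data.Rational.Properties as ℚₚ
open import Data.Bool as Bool using (Bool; true; false; _∧_; _∨_; _xor_; not)
import Data.Bool.Properties as Boolₚ
open import Data.Fin as Fin using (Fin; zero; suc; toℕ; fromℕ; fromℕ<; inject₁; inject≤;
  finToFun; funToFin; combine; remQuot; punchOut)
open import Data.Fin.Patterns using (0F; 1F; 2F; 3F)
import Data.Fin.Properties as Finₚ
open import Data.Vec using (Vec; []; _∷_; _++_; map; tail; lookup; _[_]≔_; zipWith; replicate; tabulate; toList)
import Data.Vec.Properties as Vecₚ
open import Data.Vec.Relation.Binary.Pointwise.Inductive as Pointwise using (Pointwise; []; _∷_)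
open import Data.List as List using (List; []; _∷_; length; _ʳ++_; cartesianProductWith)
open import Data.List.Extrema.Nat using (argmin; f[argmin]≤f[xs])
open import Data.List.Membership.Propositional using (_∈_; find)
open import Data.List.Membership.Propositional.Properties using (∈-cartesianProductWith⁺)
import Data.List.Properties as Listₚ
open import Data.List.Relation.Unary.All as All using (All; []; _∷_)
import Data.List.Relation.Unary.All.Properties as Allₚ
open import Data.List.Relation.Unary.AllPairs as AllPairs using (AllPairs; []; _∷_)
import Data.List.Relation.Unary.AllPairs.Properties as AllPairsₚ
open import Data.List.Relation.Unary.Any as Any using (here; there)
import Data.List.Relation.Unary.Any.Properties as Anyₚ
open import Data.Product using (Σ; _×_; _,_; ∃; proj₁; proj₂; swap; uncurry)
open import Data.Sum using (inj₁; inj₂; [_,_]′)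
open import Function using (_∘_; const; flip; mk⇔)
open import Function.Bundles using (module Inverse)
open import Function.Definitions using (Injective)
open import Relation.Binary.PropositionalEquality
open import Relation.Nullary using (yes; no; contradiction; does)
open import Relation.Nullary.Decidable using (does-⇔; from-yes; _→-dec_)

-- Skew systems of vectors

dot : ∀ {D} → Vec ℤ D → Vec ℤ D → ℤ
dot []      []      = 0ℤ
dot (x ∷ a) (y ∷ b) = x ℤ.* y ℤ.+ dot a b

-- Fraction-free elimination: the tail of `β (y ∷ b′) - y (β ∷ b)`, whose first entry cancels.
eliminate : ∀ {D} → ℤ → Vec ℤ D → ℤ → Vec ℤ D → Vec ℤ D
eliminate β []      y []       = []
eliminate β (c ∷ b) y (d ∷ b′) = β ℤ.* d ℤ.- y ℤ.* c ∷ eliminate β b y b′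

dot-eliminate : ∀ {D} β (b : Vec ℤ D) y b′ a →
  dot a (eliminate β b y b′) ≡ β ℤ.* dot a b′ ℤ.- y ℤ.* dot a b
dot-eliminate β []      y []       []      = lemma β y
  where
  lemma : ∀ β y → 0ℤ ≡ β ℤ.* 0ℤ ℤ.- y ℤ.* 0ℤ
  lemma = solve-∀
dot-eliminate β (c ∷ b) y (d ∷ b′) (x ∷ a)
  rewrite dot-eliminate β b y b′ a = lemma β c y d x (dot a b′) (dot a b)
  where
  lemma : ∀ β c y d x p q → x ℤ.* (β ℤ.* d ℤ.- y ℤ.* c) ℤ.+ (β ℤ.* p ℤ.- y ℤ.* q)
                          ≡ β ℤ.* (x ℤ.* d ℤ.+ p) ℤ.- y ℤ.* (x ℤ.* c ℤ.+ q)
  lemma = solve-∀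

-- Orthogonality to the pivot kills the correction term. When `β` is nonzero, the vanishing and the
-- nonvanishing of products therefore both survive the loss of the first coordinate.
dot-eliminate-∷ : ∀ {D} β (b : Vec ℤ D) y b′ x a →
  dot (x ∷ a) (β ∷ b) ≡ 0ℤ →
  dot a (eliminate β b y b′) ≡ β ℤ.* dot (x ∷ a) (y ∷ b′)
dot-eliminate-∷ β b y b′ x a a⊥b = begin
  dot a (eliminate β b y b′)                        ≡⟨ dot-eliminate β b y b′ a ⟩
  β ℤ.* dot a b′ ℤ.- y ℤ.* dot a b                  ≡⟨ lemma β x y (dot a b′) (dot a b) ⟩
  β ℤ.* (x ℤ.* y ℤ.+ dot a b′) ℤ.- y ℤ.* (x ℤ.* β ℤ.+ dot a b)
    ≡⟨ cong (λ z → β ℤ.* (x ℤ.* y ℤ.+ dot a b′) ℤ.- y ℤ.* z) a⊥b ⟩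
  β ℤ.* (x ℤ.* y ℤ.+ dot a b′) ℤ.- y ℤ.* 0ℤ         ≡⟨ lemma′ (β ℤ.* (x ℤ.* y ℤ.+ dot a b′)) y ⟩
  β ℤ.* (x ℤ.* y ℤ.+ dot a b′)                      ∎
  where
  open ≡-Reasoning
  lemma : ∀ β x y p q → β ℤ.* p ℤ.- y ℤ.* q ≡ β ℤ.* (x ℤ.* y ℤ.+ p) ℤ.- y ℤ.* (x ℤ.* β ℤ.+ q)
  lemma = solve-∀
  lemma′ : ∀ p y → p ℤ.- y ℤ.* 0ℤ ≡ p
  lemma′ = solve-∀

Pair : ℕ → Set
Pair D = Vec ℤ D × Vec ℤ D

Later⊥ : ∀ {D} → Pair D → Pair D → Set
Later⊥ (_ , b) (a , _) = dot a b ≡ 0ℤ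

NonOrth : ∀ {D} → Pair D → Set
NonOrth (a , b) = dot a b ≢ 0ℤ

Triangular : ∀ {D} → List (Pair D) → Set
Triangular l = All NonOrth l × AllPairs Later⊥ l

-- The last component records that the first vectors of `l′` are tails of first vectors of `l`. It
-- lets a pair put in front of `l′` stay orthogonal to what follows.
Reduction : ∀ {D} → List (Pair (suc D)) → Set₁
Reduction {D} l = ∃ λ (l′ : List (Pair D)) →
  Triangular l′ × length l ℕ.≤ suc (length l′) ×
  (∀ (Q : Vec ℤ D → Set) → All (Q ∘ tail ∘ proj₁) l → All (Q ∘ proj₁) l′)

pivot : ∀ {D} → ℤ → Vec ℤ D → Pair (suc D) → Pair D
pivot β b (x ∷ a , y ∷ b′) = a , eliminate β b y b′

0*+ : ∀ x z → x ℤ.* 0ℤ ℤ.+ z ≡ z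
0*+ = solve-∀

-- The first pair whose second vector has a nonzero leading entry serves as pivot. It is the only
-- pair lost.
reduce : ∀ {D} (l : List (Pair (suc D))) → Triangular l → Reduction l
reduce [] _ = [] , ([] , []) , z≤n , λ _ _ → []
reduce {D} ((x ∷ a , β ∷ b) ∷ l) (nz ∷ nzs , orth ∷ orths) with β ℤ.≟ 0ℤ
... | no β≢0 = List.map (pivot β b) l , (nonOrth nzs orth , later l orth orths)
             , ℕ.s≤s (ℕₚ.≤-reflexive (sym (Listₚ.length-map (pivot β b) l)))
             , λ { Q (_ ∷ qs) → Allₚ.map⁺ (All.map (λ { {(_ ∷ _ , _ ∷ _)} q → q }) qs) }
  where
  nonOrth : ∀ {l} → All NonOrth l → All (Later⊥ (x ∷ a , β ∷ b)) l →
            All NonOrth (List.map (pivot β b) l)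
  nonOrth {[]} [] [] = []
  nonOrth {(x′ ∷ a′ , y ∷ b′) ∷ _} (n ∷ ns) (o ∷ os) =
    (λ eq → [ β≢0 , n ]′ (ℤₚ.i*j≡0⇒i≡0∨j≡0 β (trans (sym (dot-eliminate-∷ β b y b′ x′ a′ o)) eq)))
    ∷ nonOrth ns os
  orthogonal : ∀ {y b′} l → All (Later⊥ (x ∷ a , β ∷ b)) l → All (λ q → dot (proj₁ q) (y ∷ b′) ≡ 0ℤ) l →
               All (λ q → dot (proj₁ q) (eliminate β b y b′) ≡ 0ℤ) (List.map (pivot β b) l)
  orthogonal [] [] [] = []
  orthogonal {y} {b′} ((x′ ∷ a′ , _ ∷ _) ∷ l) (o ∷ os) (r ∷ rs) =
    trans (dot-eliminate-∷ β b y b′ x′ a′ o) (trans (cong (β ℤ.*_) r) (ℤₚ.*-zeroʳ β))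
    ∷ orthogonal l os rs
  later : ∀ l → All (Later⊥ (x ∷ a , β ∷ b)) l → AllPairs Later⊥ l →
          AllPairs Later⊥ (List.map (pivot β b) l)
  later [] [] [] = []
  later ((_ ∷ _ , _ ∷ _) ∷ l) (_ ∷ os) (r ∷ rs) = orthogonal l os r ∷ later l os rs
-- With a leading zero in the second vector, the first coordinate contributes nothing to its
-- products, so the pair is kept and the pivot is sought further on.
... | yes refl with reduce l (nzs , orths)
...   | l′ , (nzs′ , orths′) , len , keep =
        (a , b) ∷ l′
        , ((λ eq → nz (trans (0*+ x _) eq)) ∷ nzs′
          , keep (λ a′ → dot a′ b ≡ 0ℤ) (All.map (λ { {(x′ ∷ _ , _)} o → trans (sym (0*+ x′ _)) o }) orth) ∷ orths′)
        , s≤s len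
        , λ { Q (q ∷ qs) → q ∷ keep Q qs }

triangular-length : ∀ D (l : List (Pair D)) → Triangular l → length l ℕ.≤ D
triangular-length zero    []              _            = z≤n
triangular-length zero    (([] , []) ∷ _) (nz ∷ _ , _) = contradiction refl nz
triangular-length (suc D) l               tri with reduce l tri
... | l′ , tri′ , len , _ = ℕₚ.≤-trans len (s≤s (triangular-length D l′ tri′))

-- Words as pure tensors

dot-++ : ∀ {m n} (a : Vec ℤ m) (b : Vec ℤ n) a′ b′ → dot (a ++ b) (a′ ++ b′) ≡ dot a a′ ℤ.+ dot b b′
dot-++ []      b []        b′ = sym (ℤₚ.+-identityˡ _)
dot-++ (x ∷ a) b (x′ ∷ a′) b′ rewrite dot-++ a b a′ b′ = sym (ℤₚ.+-assoc (x ℤ.* x′) _ _)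

dot-scaleˡ : ∀ {n} c (a b : Vec ℤ n) → dot (map (c ℤ.*_) a) b ≡ c ℤ.* dot a b
dot-scaleˡ c []      []      = sym (ℤₚ.*-zeroʳ c)
dot-scaleˡ c (x ∷ a) (y ∷ b) rewrite dot-scaleˡ c a b = lemma c x y (dot a b)
  where
  lemma : ∀ c x y z → c ℤ.* x ℤ.* y ℤ.+ c ℤ.* z ≡ c ℤ.* (x ℤ.* y ℤ.+ z)
  lemma = solve-∀

dot-scaleʳ : ∀ {n} c (a b : Vec ℤ n) → dot a (map (c ℤ.*_) b) ≡ c ℤ.* dot a b
dot-scaleʳ c []      []      = sym (ℤₚ.*-zeroʳ c)
dot-scaleʳ c (x ∷ a) (y ∷ b) rewrite dot-scaleʳ c a b = lemma c x y (dot a b)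
  where
  lemma : ∀ c x y z → x ℤ.* (c ℤ.* y) ℤ.+ c ℤ.* z ≡ c ℤ.* (x ℤ.* y ℤ.+ z)
  lemma = solve-∀

-- The tensor ⊗ (1, xᵢ). The trailing `++ []` follows the unfolding of `2 ^ suc k`.
monomials : ∀ {k} → Vec ℤ k → Vec ℤ (2 ^ k)
monomials []       = 1ℤ ∷ []
monomials (x ∷ xs) = monomials xs ++ (map (x ℤ.*_) (monomials xs) ++ [])

-- The dual tensor ⊗ (-yᵢ, 1): the coefficients of the polynomial ∏ (Xᵢ - yᵢ), in the order of
-- `monomials`.
coefficients : ∀ {k} → Vec ℤ k → Vec ℤ (2 ^ k)
coefficients []       = 1ℤ ∷ []
coefficients (y ∷ ys) = map ((ℤ.- y) ℤ.*_) (coefficients ys) ++ (coefficients ys ++ [])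

∏-diff : ∀ {k} → Vec ℤ k → Vec ℤ k → ℤ
∏-diff []       []       = 1ℤ
∏-diff (x ∷ xs) (y ∷ ys) = (x ℤ.- y) ℤ.* ∏-diff xs ys

dot-monomials : ∀ {k} (x y : Vec ℤ k) → dot (monomials x) (coefficients y) ≡ ∏-diff x y
dot-monomials []       []       = refl
dot-monomials (x ∷ xs) (y ∷ ys)
  rewrite dot-++ (monomials xs) (map (x ℤ.*_) (monomials xs) ++ [])
                 (map ((ℤ.- y) ℤ.*_) (coefficients ys)) (coefficients ys ++ [])
        | dot-++ (map (x ℤ.*_) (monomials xs)) [] (coefficients ys) []
        | dot-scaleʳ (ℤ.- y) (monomials xs) (coefficients ys)
        | dot-scaleˡ x (monomials xs) (coefficients ys)
        | dot-monomials xs ys = lemma x y (∏-diff xs ys)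
  where
  lemma : ∀ x y z → (ℤ.- y) ℤ.* z ℤ.+ (x ℤ.* z ℤ.+ 0ℤ) ≡ (x ℤ.- y) ℤ.* z
  lemma = solve-∀

bit : Bool → ℕ
bit false = 0
bit true  = 1

bits : List Bool → ℕ
bits []       = 0
bits (b ∷ bs) = bit b ℕ.+ 2 ℕ.* bits bs

bits-∷-injective : ∀ b c m n → bit b ℕ.+ 2 ℕ.* m ≡ bit c ℕ.+ 2 ℕ.* n → b ≡ c × m ≡ n
bits-∷-injective false false m n eq = refl , ℕₚ.*-cancelˡ-≡ m n 2 eq
bits-∷-injective true  true  m n eq = refl , ℕₚ.*-cancelˡ-≡ m n 2 (ℕₚ.suc-injective eq)
bits-∷-injective false true  m n eq = contradiction eq (ℕₚ.even≢odd m n)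
bits-∷-injective true  false m n eq = contradiction (sym eq) (ℕₚ.even≢odd n m)

bits-injective : ∀ {A : Set} {f g : A → Bool} xs → bits (List.map f xs) ≡ bits (List.map g xs) →
                 All (λ x → f x ≡ g x) xs
bits-injective []       eq = []
bits-injective {f = f} {g} (x ∷ xs) eq with bits-∷-injective (f x) (g x) _ _ eq
... | fx≡gx , eqs = fx≡gx ∷ bits-injective xs eqs

-- Letters become integers so that a common letter of two words is a zero factor of `∏-diff`.
code : ∀ {d} → Vec Bool d → ℤ
code s = + bits (toList s)

code-injective : ∀ {d} (s t : Vec Bool d) → code s ≡ code t → s ≡ t
code-injective s t eq = go s t (ℤₚ.+-injective eq)
  where
  go : ∀ {d} (s t : Vec Bool d) → bits (toList s) ≡ bits (toList t) → s ≡ t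
  go []      []      eq = refl
  go (b ∷ s) (c ∷ t) eq with bits-∷-injective b c _ _ eq
  ... | b≡c , eqs = cong₂ _∷_ b≡c (go s t eqs)

_≟ᵥ_ : ∀ {d} (s t : Vec Bool d) → _
_≟ᵥ_ = Vecₚ.≡-dec Bool._≟_

meet : ∀ {d k} → Vec (Vec Bool d) k → Vec (Vec Bool d) k → Bool
meet []      []      = false
meet (s ∷ x) (t ∷ y) = does (s ≟ᵥ t) ∨ meet x y

meet-sym : ∀ {d k} (x y : Vec (Vec Bool d) k) → meet x y ≡ meet y x
meet-sym []      []      = refl
meet-sym (s ∷ x) (t ∷ y) with s ≟ᵥ t | t ≟ᵥ s
... | yes _    | yes _    = refl
... | no  _    | no  _    = meet-sym x y
... | yes refl | no  t≢t  = contradiction refl t≢t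
... | no  s≢s  | yes refl = contradiction refl s≢s

codes : ∀ {d k} → Vec (Vec Bool d) k → Vec ℤ k
codes = map code

meet⇒∏-diff≡0 : ∀ {d k} (x y : Vec (Vec Bool d) k) → meet x y ≡ true → ∏-diff (codes x) (codes y) ≡ 0ℤ
meet⇒∏-diff≡0 []      []      ()
meet⇒∏-diff≡0 (s ∷ x) (t ∷ y) eq with s ≟ᵥ t
... | yes refl = cong (ℤ._* ∏-diff (codes x) (codes y)) (ℤₚ.+-inverseʳ (code s))
... | no  _    = trans (cong ((code s ℤ.- code t) ℤ.*_) (meet⇒∏-diff≡0 x y eq)) (ℤₚ.*-zeroʳ (code s ℤ.- code t))

∏-diff≡0⇒meet : ∀ {d k} (x y : Vec (Vec Bool d) k) → ∏-diff (codes x) (codes y) ≡ 0ℤ → meet x y ≡ true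
∏-diff≡0⇒meet []      []      ()
∏-diff≡0⇒meet (s ∷ x) (t ∷ y) eq with s ≟ᵥ t
... | yes _   = refl
... | no  s≢t with ℤₚ.i*j≡0⇒i≡0∨j≡0 (code s ℤ.- code t) eq
...   | inj₁ s-t≡0 = contradiction (code-injective s t (ℤₚ.i-j≡0⇒i≡j (code s) (code t) s-t≡0)) s≢t
...   | inj₂ rest  = ∏-diff≡0⇒meet x y rest

Word : ℕ → ℕ → Set
Word d k = Vec (Vec Bool d) k

LaterMeet : ∀ {d k} → Word d k × Word d k → Word d k × Word d k → Set
LaterMeet (_ , w) (y , _) = meet y w ≡ true

Avoid : ∀ {d k} → Word d k × Word d k → Set
Avoid (y , w) = meet y w ≡ false

Clique : ∀ {d k} → Word d k × Word d k → Word d k × Word d k → Set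
Clique (y , _) (y′ , _) = meet y y′ ≡ true

-- Meeting is the vanishing of `∏-diff`, so the tensors of the y and the dual tensors of the w form
-- a triangular system in dimension `2 ^ k`.
skew-length : ∀ {d k} (l : List (Word d k × Word d k)) → All Avoid l → AllPairs LaterMeet l →
              length l ℕ.≤ 2 ^ k
skew-length {k = k} l avoid later = subst (ℕ._≤ 2 ^ k) (Listₚ.length-map embed l)
  (triangular-length (2 ^ k) (List.map embed l)
    ( Allₚ.map⁺ (All.map (λ { {y , w} → nonOrth y w }) avoid)
    , AllPairsₚ.map⁺ (AllPairs.map (λ { {_ , w} {y , _} → orth y w }) later)))
  where
  embed : Word _ k × Word _ k → Pair (2 ^ k)
  embed (y , w) = monomials (codes y) , coefficients (codes w)
  orth : ∀ y w → meet y w ≡ true → dot (monomials (codes y)) (coefficients (codes w)) ≡ 0ℤ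
  orth y w eq = trans (dot-monomials (codes y) (codes w)) (meet⇒∏-diff≡0 y w eq)
  nonOrth : ∀ y w → meet y w ≡ false → dot (monomials (codes y)) (coefficients (codes w)) ≢ 0ℤ
  nonOrth y w ne eq with trans (sym ne) (∏-diff≡0⇒meet y w (trans (sym (dot-monomials (codes y) (codes w))) eq))
  ... | ()

All-ʳ++⁺ : ∀ {A : Set} {P : A → Set} {xs ys} → All P xs → All P ys → All P (xs ʳ++ ys)
All-ʳ++⁺ []         pys = pys
All-ʳ++⁺ (px ∷ pxs) pys = All-ʳ++⁺ pxs (px ∷ pys)

AllPairs-ʳ++⁺ : ∀ {A : Set} {R : A → A → Set} {xs ys} → AllPairs (flip R) xs → AllPairs R ys →
                All (λ x → All (R x) ys) xs → AllPairs R (xs ʳ++ ys)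
AllPairs-ʳ++⁺ []          rys []          = rys
AllPairs-ʳ++⁺ (rx ∷ rxs) rys (cx ∷ cxs) = AllPairs-ʳ++⁺ rxs (cx ∷ rys) (All.zipWith (λ { (r , c) → r ∷ c }) (rx , cxs))

-- The words y meet each other, so the reversed pairs (w , y) continue the skew sequence; for the
-- tensors this says that a totally isotropic subspace has at most half the dimension.
skew-clique-length : ∀ {d k} (l : List (Word d k × Word d k)) → All Avoid l → AllPairs LaterMeet l →
                     All (λ p → All (Clique p) l) l → length l ℕ.+ length l ℕ.≤ 2 ^ k
skew-clique-length {k = k} l avoid later clique = subst (ℕ._≤ 2 ^ k) length≡
  (skew-length (List.map swap l ʳ++ l)
    (All-ʳ++⁺ (Allₚ.map⁺ (All.map (λ { {y , w} a → trans (meet-sym w y) a }) avoid)) avoid)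
    (AllPairs-ʳ++⁺
      (AllPairsₚ.map⁺ (AllPairs.map (λ { {_ , w} {y , _} m → trans (meet-sym w y) m }) later))
      later
      (Allₚ.map⁺ (All.map (λ { {y , _} → All.map (λ { {y′ , _} m → trans (meet-sym y′ y) m }) }) clique))))
  where
  length≡ : length (List.map swap l ʳ++ l) ≡ length l ℕ.+ length l
  length≡ = trans (Listₚ.length-ʳ++ (List.map swap l)) (cong (ℕ._+ length l) (Listₚ.length-map swap l))

-- Flags of cubes, modulo 2

data Cell : Set where
  pt : ℕ → Cell
  iv : ℕ → Cell

data _∈ᶜ_ : ℕ → Cell → Set where
  at : ∀ {j} → j ∈ᶜ pt j
  lo : ∀ {j} → j ∈ᶜ iv j
  hi : ∀ {j} → suc j ∈ᶜ iv j

Face : ℕ → Set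
Face = Vec Cell

_∈ᶠ_ : ∀ {d} → Vec ℕ d → Face d → Set
_∈ᶠ_ = Pointwise _∈ᶜ_

-- The coboundary modulo 2 of the cochain `f`, evaluated at `F`: each `iv` coordinate yields two
-- facets, each `pt` coordinate none.
∂ : ∀ {d} → (Face d → Bool) → Face d → Bool
∂ f []         = false
∂ f (pt j ∷ F) = ∂ (f ∘ (pt j ∷_)) F
∂ f (iv j ∷ F) = (f (pt j ∷ F) xor f (pt (suc j) ∷ F)) xor ∂ (f ∘ (iv j ∷_)) F

xor-interchange : ∀ a b c d → (a xor b) xor (c xor d) ≡ (a xor c) xor (b xor d)
xor-interchange false false c d = refl
xor-interchange false true  false d = refl
xor-interchange false true  true  d = refl
xor-interchange true  false c d = Boolₚ.not-distribˡ-xor c d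
xor-interchange true  true  false d = sym (Boolₚ.not-involutive d)
xor-interchange true  true  true  d = refl

xor-cancelˡ : ∀ a b → a xor (a xor b) ≡ b
xor-cancelˡ false b = refl
xor-cancelˡ true  b = Boolₚ.not-involutive b

∂-cong : ∀ {d} {f g : Face d → Bool} → (∀ F → f F ≡ g F) → ∀ F → ∂ f F ≡ ∂ g F
∂-cong f≗g []         = refl
∂-cong f≗g (pt j ∷ F) = ∂-cong (f≗g ∘ (pt j ∷_)) F
∂-cong f≗g (iv j ∷ F) = cong₂ _xor_ (cong₂ _xor_ (f≗g (pt j ∷ F)) (f≗g (pt (suc j) ∷ F)))
                                    (∂-cong (f≗g ∘ (iv j ∷_)) F)

∂-xor : ∀ {d} (f g : Face d → Bool) F → ∂ (λ G → f G xor g G) F ≡ ∂ f F xor ∂ g F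
∂-xor f g []         = refl
∂-xor f g (pt j ∷ F) = ∂-xor (f ∘ (pt j ∷_)) (g ∘ (pt j ∷_)) F
∂-xor f g (iv j ∷ F) = begin
  ((f₀ xor g₀) xor (f₁ xor g₁)) xor ∂ (λ G → f (iv j ∷ G) xor g (iv j ∷ G)) F
    ≡⟨ cong₂ _xor_ (xor-interchange f₀ g₀ f₁ g₁) (∂-xor (f ∘ (iv j ∷_)) (g ∘ (iv j ∷_)) F) ⟩
  ((f₀ xor f₁) xor (g₀ xor g₁)) xor (∂ (f ∘ (iv j ∷_)) F xor ∂ (g ∘ (iv j ∷_)) F)
    ≡⟨ xor-interchange (f₀ xor f₁) (g₀ xor g₁) _ _ ⟩
  ((f₀ xor f₁) xor ∂ (f ∘ (iv j ∷_)) F) xor ((g₀ xor g₁) xor ∂ (g ∘ (iv j ∷_)) F) ∎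
  where
  open ≡-Reasoning
  f₀ = f (pt j ∷ F)
  f₁ = f (pt (suc j) ∷ F)
  g₀ = g (pt j ∷ F)
  g₁ = g (pt (suc j) ∷ F)

∂-const : ∀ {d} b (F : Face d) → ∂ (const b) F ≡ false
∂-const b []         = refl
∂-const b (pt j ∷ F) = ∂-const b F
∂-const b (iv j ∷ F) = cong₂ _xor_ (Boolₚ.xor-same b) (∂-const b F)

∂-scale : ∀ {d} b (f : Face d → Bool) F → ∂ (λ G → f G ∧ b) F ≡ ∂ f F ∧ b
∂-scale true  f F = trans (∂-cong (λ G → Boolₚ.∧-identityʳ (f G)) F) (sym (Boolₚ.∧-identityʳ (∂ f F)))
∂-scale false f F = trans (∂-cong (λ G → Boolₚ.∧-zeroʳ (f G)) F)
                          (trans (∂-const false F) (sym (Boolₚ.∧-zeroʳ (∂ f F))))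

-- Each face of codimension two lies in exactly two facets of `F`, so its two occurrences cancel.
∂-∂ : ∀ {d} (f : Face d → Bool) F → ∂ (∂ f) F ≡ false
∂-∂ f []         = refl
∂-∂ f (pt j ∷ F) = ∂-∂ (f ∘ (pt j ∷_)) F
∂-∂ f (iv j ∷ F) = begin
  (∂ f₀ F xor ∂ f₁ F) xor ∂ (λ G → (f₀ G xor f₁ G) xor ∂ f₂ G) F
    ≡⟨ cong ((∂ f₀ F xor ∂ f₁ F) xor_) (∂-xor (λ G → f₀ G xor f₁ G) (∂ f₂) F) ⟩
  (∂ f₀ F xor ∂ f₁ F) xor (∂ (λ G → f₀ G xor f₁ G) F xor ∂ (∂ f₂) F)
    ≡⟨ cong₂ (λ x y → (∂ f₀ F xor ∂ f₁ F) xor (x xor y)) (∂-xor f₀ f₁ F) (∂-∂ f₂ F) ⟩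
  (∂ f₀ F xor ∂ f₁ F) xor ((∂ f₀ F xor ∂ f₁ F) xor false)
    ≡⟨ xor-cancelˡ (∂ f₀ F xor ∂ f₁ F) false ⟩
  false ∎
  where
  open ≡-Reasoning
  f₀ = f ∘ (pt j ∷_)
  f₁ = f ∘ (pt (suc j) ∷_)
  f₂ = f ∘ (iv j ∷_)

∂-update : ∀ {d} {f g : Face d → Bool} {x y} i →
           (∀ F → f (F [ i ]≔ pt x) ≡ g (F [ i ]≔ pt y)) →
           ∀ F → ∂ f (F [ i ]≔ pt x) ≡ ∂ g (F [ i ]≔ pt y)
∂-update zero    eq (c ∷ F)    = ∂-cong (eq ∘ (c ∷_)) F
∂-update (suc i) eq (pt j ∷ F) = ∂-update i (eq ∘ (pt j ∷_)) F
∂-update (suc i) eq (iv j ∷ F) = cong₂ _xor_ (cong₂ _xor_ (eq (pt j ∷ F)) (eq (pt (suc j) ∷ F)))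
                                             (∂-update i (eq ∘ (iv j ∷_)) F)

_⊑_ : ∀ {d} → Face d → Face d → Set
G ⊑ F = ∀ {v} → v ∈ᶠ G → v ∈ᶠ F

∂-witness : ∀ {d} (f : Face d → Bool) F → ∂ f F ≡ true → ∃ λ G → G ⊑ F × f G ≡ true
∂-witness f []         ()
∂-witness f (pt j ∷ F) eq with ∂-witness (f ∘ (pt j ∷_)) F eq
... | G , G⊑F , fG = pt j ∷ G , (λ { (x ∷ v) → x ∷ G⊑F v }) , fG
∂-witness f (iv j ∷ F) eq with f (pt j ∷ F) in eq₀ | f (pt (suc j) ∷ F) in eq₁
... | true  | _    = pt j ∷ F , (λ { (at ∷ v) → lo ∷ v }) , eq₀
... | false | true = pt (suc j) ∷ F , (λ { (at ∷ v) → hi ∷ v }) , eq₁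
... | false | false with ∂-witness (f ∘ (iv j ∷_)) F eq
...   | G , G⊑F , fG = iv j ∷ G , (λ { (x ∷ v) → x ∷ G⊑F v }) , fG

-- The parity of the number of flags F₀ ⊂ … ⊂ Fₑ = F, the dimension rising by one at each step, along
-- which the e-th label changes at Fₑ, the (e-1)-st at Fₑ₋₁, and so on; summing h at the facets alone
-- is enough since the flags ending on the boundary of F cancel (∂-flags).
flags : ∀ {d e} → Vec (Face d → Bool) e → Face d → Bool
flags []       F = true
flags (h ∷ hs) F = ∂ (λ G → flags hs G ∧ h G) F

-- With no labels this says that a face has an even number of facets; otherwise `flags` is itself a
-- coboundary.
∂-flags : ∀ {d e} (hs : Vec (Face d → Bool) e) F → ∂ (flags hs) F ≡ false
∂-flags []       F = ∂-const true F
∂-flags (h ∷ hs) F = ∂-∂ (λ G → flags hs G ∧ h G) F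

-- The constant contributes a multiple of `∂ (flags hs)`, which vanishes. Hence only the changes of
-- `h` matter, not its values.
flags-shift : ∀ {d e} b (h : Face d → Bool) (hs : Vec (Face d → Bool) e) F →
              ∂ (λ G → flags hs G ∧ (b xor h G)) F ≡ flags (h ∷ hs) F
flags-shift b h hs F = begin
  ∂ (λ G → flags hs G ∧ (b xor h G)) F
    ≡⟨ ∂-cong (λ G → Boolₚ.∧-distribˡ-xor (flags hs G) b (h G)) F ⟩
  ∂ (λ G → (flags hs G ∧ b) xor (flags hs G ∧ h G)) F
    ≡⟨ ∂-xor (λ G → flags hs G ∧ b) _ F ⟩
  ∂ (λ G → flags hs G ∧ b) F xor flags (h ∷ hs) F
    ≡⟨ cong (_xor flags (h ∷ hs) F) (trans (∂-scale b (flags hs) F) (cong (_∧ b) (∂-flags hs F))) ⟩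
  flags (h ∷ hs) F ∎
  where open ≡-Reasoning

flags-witness : ∀ {d e} (h : Face d → Bool) (hs : Vec (Face d → Bool) e) F → flags (h ∷ hs) F ≡ true →
                ∃ λ G → G ⊑ F × flags hs G ≡ true × h F ≢ h G
-- Shifting `h` by its value at `F` turns the summand at `G` into the condition that the label
-- changes between `G` and `F`.
flags-witness h hs F eq with ∂-witness _ F (trans (flags-shift (h F) h hs F) eq)
... | G , G⊑F , fG with flags hs G in eqG
...   | true = G , G⊑F , eqG , λ hF≡hG →
  contradiction (trans (sym (Boolₚ.xor-same (h F))) (trans (cong (h F xor_) hF≡hG) fG)) λ ()

-- The constants drop out by `flags-shift`, so labels that are periodic only up to constants still
-- have a periodic flag count.
flags-periodic : ∀ {d e x} i (hs : Vec (Face d → Bool) e) →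
  (∀ l → ∃ λ b → ∀ F → lookup hs l (F [ i ]≔ pt x) ≡ b xor lookup hs l (F [ i ]≔ pt 0)) →
  ∀ F → flags hs (F [ i ]≔ pt x) ≡ flags hs (F [ i ]≔ pt 0)
flags-periodic i []       tw F = refl
flags-periodic i (h ∷ hs) tw F with tw zero
... | b , twₕ = trans
  (∂-update i (λ G → cong₂ _∧_ (flags-periodic i hs (tw ∘ suc) G) (twₕ G)) F)
  (flags-shift b h hs (F [ i ]≔ pt 0))

flags-restrict : ∀ {d e} c (hs : Vec (Face (suc d) → Bool) e) F →
                 flags hs (pt c ∷ F) ≡ flags (map (_∘ (pt c ∷_)) hs) F
flags-restrict c []       F = refl
flags-restrict c (h ∷ hs) F = ∂-cong (λ G → cong (_∧ h (pt c ∷ G)) (flags-restrict c hs G)) F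

-- Sums over the cubes of a box

⨁ : ℕ → (ℕ → Bool) → Bool
⨁ zero    g = false
⨁ (suc m) g = ⨁ m g xor g m

⨁-cong : ∀ m {g h : ℕ → Bool} → (∀ j → g j ≡ h j) → ⨁ m g ≡ ⨁ m h
⨁-cong zero    eq = refl
⨁-cong (suc m) eq = cong₂ _xor_ (⨁-cong m eq) (eq m)

⨁-xor : ∀ m (g h : ℕ → Bool) → ⨁ m (λ j → g j xor h j) ≡ ⨁ m g xor ⨁ m h
⨁-xor zero    g h = refl
⨁-xor (suc m) g h = trans (cong (_xor (g m xor h m)) (⨁-xor m g h))
                          (xor-interchange (⨁ m g) (⨁ m h) (g m) (h m))

⨁-false : ∀ m → ⨁ m (const false) ≡ false
⨁-false zero    = refl
⨁-false (suc m) = cong (_xor false) (⨁-false m)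

⨁-telescope : ∀ m (g : ℕ → Bool) → ⨁ m (λ j → g j xor g (suc j)) ≡ g 0 xor g m
⨁-telescope zero    g = sym (Boolₚ.xor-same (g 0))
⨁-telescope (suc m) g = begin
  ⨁ m (λ j → g j xor g (suc j)) xor (g m xor g (suc m))  ≡⟨ cong₂ _xor_ (⨁-telescope m g) refl ⟩
  (g 0 xor g m) xor (g m xor g (suc m))                  ≡⟨ Boolₚ.xor-assoc (g 0) (g m) _ ⟩
  g 0 xor (g m xor (g m xor g (suc m)))                  ≡⟨ cong (g 0 xor_) (xor-cancelˡ (g m) _) ⟩
  g 0 xor g (suc m)                                      ∎
  where open ≡-Reasoning

∑cubes : ℕ → ∀ {d} → (Face d → Bool) → Bool
∑cubes m {zero}  f = f []
∑cubes m {suc d} f = ⨁ m (λ j → ∑cubes m (f ∘ (iv j ∷_)))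

∑cubes-cong : ∀ m {d} {f g : Face d → Bool} → (∀ F → f F ≡ g F) → ∑cubes m f ≡ ∑cubes m g
∑cubes-cong m {zero}  eq = eq []
∑cubes-cong m {suc d} eq = ⨁-cong m (λ j → ∑cubes-cong m (eq ∘ (iv j ∷_)))

∑cubes-xor : ∀ m {d} (f g : Face d → Bool) →
             ∑cubes m (λ F → f F xor g F) ≡ ∑cubes m f xor ∑cubes m g
∑cubes-xor m {zero}  f g = refl
∑cubes-xor m {suc d} f g = trans (⨁-cong m (λ j → ∑cubes-xor m (f ∘ (iv j ∷_)) (g ∘ (iv j ∷_))))
                                 (⨁-xor m _ _)

-- Stokes' formula along the first axis: the walls inside the box telescope, which leaves the two
-- outer ones and the coboundaries within the slabs.
∑cubes-∂ : ∀ m {d} (f : Face (suc d) → Bool) →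
  ∑cubes m (∂ f) ≡ ∑cubes m (λ F → f (pt 0 ∷ F) xor f (pt m ∷ F)) xor ⨁ m (λ j → ∑cubes m (∂ (f ∘ (iv j ∷_))))
∑cubes-∂ m f = begin
  ⨁ m (λ j → ∑cubes m (λ F → (f (pt j ∷ F) xor f (pt (suc j) ∷ F)) xor ∂ (f ∘ (iv j ∷_)) F))
    ≡⟨ ⨁-cong m (λ j → trans (∑cubes-xor m (λ F → f (pt j ∷ F) xor f (pt (suc j) ∷ F)) (∂ (f ∘ (iv j ∷_))))
                             (cong₂ _xor_ (∑cubes-xor m (f ∘ (pt j ∷_)) (f ∘ (pt (suc j) ∷_))) refl)) ⟩
  ⨁ m (λ j → (side j xor side (suc j)) xor ∑cubes m (∂ (f ∘ (iv j ∷_))))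
    ≡⟨ ⨁-xor m (λ j → side j xor side (suc j)) _ ⟩
  ⨁ m (λ j → side j xor side (suc j)) xor ⨁ m (λ j → ∑cubes m (∂ (f ∘ (iv j ∷_))))
    ≡⟨ cong₂ _xor_ (trans (⨁-telescope m side) (sym (∑cubes-xor m (f ∘ (pt 0 ∷_)) (f ∘ (pt m ∷_))))) refl ⟩
  ∑cubes m (λ F → f (pt 0 ∷ F) xor f (pt m ∷ F)) xor ⨁ m (λ j → ∑cubes m (∂ (f ∘ (iv j ∷_)))) ∎
  where
  open ≡-Reasoning
  side : ℕ → Bool
  side j = ∑cubes m (f ∘ (pt j ∷_))

∑cubes-false : ∀ m d → ∑cubes m {d} (const false) ≡ false
∑cubes-false m zero    = refl
∑cubes-false m (suc d) = trans (⨁-cong m (λ _ → ∑cubes-false m d)) (⨁-false m)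

-- Opposite outer walls cancel, as the box closes up to a torus.
∑cubes-∂-periodic : ∀ m {d} (f : Face d → Bool) → (∀ i F → f (F [ i ]≔ pt m) ≡ f (F [ i ]≔ pt 0)) →
                    ∑cubes m (∂ f) ≡ false
∑cubes-∂-periodic m {zero}  f per = refl
∑cubes-∂-periodic m {suc d} f per = trans (∑cubes-∂ m f) (cong₂ _xor_
  (trans (∑cubes-cong m (λ F → trans (cong (f (pt 0 ∷ F) xor_) (per zero (pt 0 ∷ F))) (Boolₚ.xor-same (f (pt 0 ∷ F)))))
         (∑cubes-false m d))
  (trans (⨁-cong m (λ j → ∑cubes-∂-periodic m (f ∘ (iv j ∷_)) (λ i → per (suc i) ∘ (iv j ∷_)))) (⨁-false m)))

-- The coordinates of a labelling equivariant under the deck group: bit `l` flips along axis `l` and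
-- is periodic along the other axes.
Twisted : ℕ → ∀ {d} → Vec (Face d → Bool) d → Set
Twisted m hs = ∀ l i F → lookup hs l (F [ i ]≔ pt m) ≡ does (l Fin.≟ i) xor lookup hs l (F [ i ]≔ pt 0)

∧-xor-not : ∀ a b → (a ∧ b) xor (a ∧ not b) ≡ a
∧-xor-not false b     = refl
∧-xor-not true  false = refl
∧-xor-not true  true  = refl

-- A degree argument modulo 2 in the manner of Borsuk and Ulam. The summand `g` is periodic along
-- every axis but the first, where `h` flips and `flags hs` does not. The two end walls thus add up
-- to the flag count of the remaining labels on the wall at 0, and induction on the dimension
-- applies.
∑cubes-flags : ∀ m {d} (hs : Vec (Face d → Bool) d) → Twisted m hs → ∑cubes m (flags hs) ≡ true
∑cubes-flags m []       tw = refl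
∑cubes-flags m (h ∷ hs) tw = begin
  ∑cubes m (∂ g)
    ≡⟨ ∑cubes-∂ m g ⟩
  ∑cubes m (λ F → g (pt 0 ∷ F) xor g (pt m ∷ F)) xor ⨁ m (λ j → ∑cubes m (∂ (g ∘ (iv j ∷_))))
    ≡⟨ cong₂ _xor_ (∑cubes-cong m ends)
         (trans (⨁-cong m (λ j → ∑cubes-∂-periodic m (g ∘ (iv j ∷_)) (λ i → sides i ∘ (iv j ∷_)))) (⨁-false m)) ⟩
  ∑cubes m (flags (map (_∘ (pt 0 ∷_)) hs)) xor false
    ≡⟨ cong (_xor false) (∑cubes-flags m (map (_∘ (pt 0 ∷_)) hs) twisted) ⟩
  true ∎
  where
  open ≡-Reasoning
  g : Face _ → Bool
  g G = flags hs G ∧ h G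
  periodic : ∀ i F → flags hs (F [ i ]≔ pt m) ≡ flags hs (F [ i ]≔ pt 0)
  periodic i = flags-periodic i hs (λ l → does (suc l Fin.≟ i) , tw (suc l) i)
  sides : ∀ i F → g (F [ suc i ]≔ pt m) ≡ g (F [ suc i ]≔ pt 0)
  sides i F = cong₂ _∧_ (periodic (suc i) F) (tw zero (suc i) F)
  ends : ∀ F → g (pt 0 ∷ F) xor g (pt m ∷ F) ≡ flags (map (_∘ (pt 0 ∷_)) hs) F
  ends F = trans
    (cong (g (pt 0 ∷ F) xor_) (cong₂ _∧_ (periodic zero (pt 0 ∷ F)) (tw zero zero (pt 0 ∷ F))))
    (trans (∧-xor-not (flags hs (pt 0 ∷ F)) (h (pt 0 ∷ F))) (flags-restrict 0 hs F))
  twisted : Twisted m (map (_∘ (pt 0 ∷_)) hs)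
  twisted l i F = subst (λ f → f (F [ i ]≔ pt m) ≡ does (l Fin.≟ i) xor f (F [ i ]≔ pt 0))
                        (sym (Vecₚ.lookup-map l (_∘ (pt 0 ∷_)) hs)) (tw (suc l) (suc i) (pt 0 ∷ F))

∑cubes-witness : ∀ m {d} (f : Face d → Bool) → ∑cubes m f ≡ true → ∃ λ F → f F ≡ true
∑cubes-witness m {zero}  f eq = [] , eq
∑cubes-witness m {suc d} f eq with ⨁-witness m _ eq
  where
  ⨁-witness : ∀ m g → ⨁ m g ≡ true → ∃ λ j → g j ≡ true
  ⨁-witness (suc m) g eq with g m in eqₘ
  ... | true  = m , eqₘ
  ... | false = ⨁-witness m g (trans (sym (Boolₚ.xor-identityʳ _)) eq)
... | j , eqⱼ with ∑cubes-witness m (f ∘ (iv j ∷_)) eqⱼ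
...   | F , fF = iv j ∷ F , fF

-- Labelling the faces

every : ∀ {d} → (Vec ℕ d → Bool) → Face d → Bool
every f []         = f []
every f (pt j ∷ F) = every (f ∘ (j ∷_)) F
every f (iv j ∷ F) = every (f ∘ (j ∷_)) F ∧ every (f ∘ (suc j ∷_)) F

every⁺ : ∀ {d} (f : Vec ℕ d → Bool) F → (∀ {v} → v ∈ᶠ F → f v ≡ true) → every f F ≡ true
every⁺ f []         all = all []
every⁺ f (pt j ∷ F) all = every⁺ (f ∘ (j ∷_)) F (λ v∈F → all (at ∷ v∈F))
every⁺ f (iv j ∷ F) all = cong₂ _∧_ (every⁺ (f ∘ (j ∷_)) F (λ v∈F → all (lo ∷ v∈F)))
                                    (every⁺ (f ∘ (suc j ∷_)) F (λ v∈F → all (hi ∷ v∈F)))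

every-witness : ∀ {d} (f : Vec ℕ d → Bool) F → every f F ≡ false → ∃ λ v → v ∈ᶠ F × f v ≡ false
every-witness f []         eq = [] , [] , eq
every-witness f (pt j ∷ F) eq with every-witness (f ∘ (j ∷_)) F eq
... | v , v∈F , fv = j ∷ v , at ∷ v∈F , fv
every-witness f (iv j ∷ F) eq with every (f ∘ (j ∷_)) F in eq₀
... | false with every-witness (f ∘ (j ∷_)) F eq₀
...   | v , v∈F , fv = j ∷ v , lo ∷ v∈F , fv
every-witness f (iv j ∷ F) eq | true with every-witness (f ∘ (suc j ∷_)) F eq
...   | v , v∈F , fv = suc j ∷ v , hi ∷ v∈F , fv

every⁻ : ∀ {d} (f : Vec ℕ d → Bool) {F v} → every f F ≡ true → v ∈ᶠ F → f v ≡ true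
every⁻ f {[]}       eq []          = eq
every⁻ f {pt j ∷ F} eq (at ∷ v∈F) = every⁻ (f ∘ (j ∷_)) eq v∈F
every⁻ f {iv j ∷ F} eq (x ∷ v∈F) with every (f ∘ (j ∷_)) F in eq₀
every⁻ f {iv j ∷ F} eq (lo ∷ v∈F) | true = every⁻ (f ∘ (j ∷_)) eq₀ v∈F
every⁻ f {iv j ∷ F} eq (hi ∷ v∈F) | true = every⁻ (f ∘ (suc j ∷_)) eq v∈F

every-update : ∀ {d} {f g : Vec ℕ d → Bool} {x y} i → (∀ v → f (v [ i ]≔ x) ≡ g (v [ i ]≔ y)) →
               ∀ F → every f (F [ i ]≔ pt x) ≡ every g (F [ i ]≔ pt y)
every-update {f = f} {g} {x} {y} zero eq (_ ∷ F) = every-cong (λ v → eq (x ∷ v)) F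
  where
  every-cong : ∀ {d} {f g : Vec ℕ d → Bool} → (∀ v → f v ≡ g v) → ∀ F → every f F ≡ every g F
  every-cong eq []         = eq []
  every-cong eq (pt j ∷ F) = every-cong (eq ∘ (j ∷_)) F
  every-cong eq (iv j ∷ F) = cong₂ _∧_ (every-cong (eq ∘ (j ∷_)) F) (every-cong (eq ∘ (suc j ∷_)) F)
every-update (suc i) eq (pt j ∷ F) = every-update i (eq ∘ (j ∷_)) F
every-update (suc i) eq (iv j ∷ F) =
  cong₂ _∧_ (every-update i (eq ∘ (j ∷_)) F) (every-update i (eq ∘ (suc j ∷_)) F)

vertex : ∀ {d} (F : Face d) → ∃ λ v → v ∈ᶠ F
vertex F with every-witness (const false) F (lemma F)
  where
  lemma : ∀ {d} (F : Face d) → every (const false) F ≡ false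
  lemma []         = refl
  lemma (pt j ∷ F) = lemma F
  lemma (iv j ∷ F) = cong (_∧ every (const false) F) (lemma F)
... | v , v∈F , _ = v , v∈F

-- Words and their translates

vecs : ∀ {A : Set} → List A → ∀ n → List (Vec A n)
vecs xs zero    = [] ∷ []
vecs xs (suc n) = cartesianProductWith _∷_ xs (vecs xs n)

∈-vecs : ∀ {A : Set} {xs : List A} → (∀ x → x ∈ xs) → ∀ {n} (v : Vec A n) → v ∈ vecs xs n
∈-vecs full []      = here refl
∈-vecs full (x ∷ v) = ∈-cartesianProductWith⁺ _∷_ (full x) (∈-vecs full v)

bools : List Bool
bools = false ∷ true ∷ []

∈-bools : ∀ b → b ∈ bools
∈-bools false = here refl
∈-bools true  = there (here refl)

signs : ∀ d → List (Vec Bool d)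
signs = vecs bools

words : ∀ d k → List (Word d k)
words d = vecs (signs d)

_⊕_ : ∀ {d} → Vec Bool d → Vec Bool d → Vec Bool d
_⊕_ = zipWith _xor_

⊕-cancelˡ : ∀ {d} (s t : Vec Bool d) → s ⊕ (s ⊕ t) ≡ t
⊕-cancelˡ []      []      = refl
⊕-cancelˡ (b ∷ s) (c ∷ t) = cong₂ _∷_ (xor-cancelˡ b c) (⊕-cancelˡ s t)

⊕-fixed : ∀ {d} (a s t : Vec Bool d) → a ≡ t ⊕ (s ⊕ a) → t ≡ s
⊕-fixed []      []      []      eq = refl
⊕-fixed (a ∷ as) (s ∷ ss) (t ∷ ts) eq =
  cong₂ _∷_ (lemma a s t (Vecₚ.∷-injectiveˡ eq)) (⊕-fixed as ss ts (Vecₚ.∷-injectiveʳ eq))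
  where
  lemma : ∀ a s t → a ≡ t xor (s xor a) → t ≡ s
  lemma a     false false eq = refl
  lemma a     true  true  eq = refl
  lemma false false true  ()
  lemma true  false true  ()
  lemma false true  false ()
  lemma true  true  false ()

shift : ∀ {d k} → Vec Bool d → Word d k → Word d k
shift t = map (t ⊕_)

shift-cancel : ∀ {d k} (s : Vec Bool d) (y : Word d k) → shift s (shift s y) ≡ y
shift-cancel s []      = refl
shift-cancel s (a ∷ y) = cong₂ _∷_ (⊕-cancelˡ s a) (shift-cancel s y)

meet-shift : ∀ {d k} (s : Vec Bool d) (x y : Word d k) → meet (shift s x) y ≡ meet x (shift s y)
meet-shift s []      []      = refl
meet-shift s (a ∷ x) (b ∷ y) = cong₂ _∨_
  (does-⇔ (mk⇔ (λ { refl → sym (⊕-cancelˡ s a) }) (λ { refl → ⊕-cancelˡ s b })) ((s ⊕ a) ≟ᵥ b) (a ≟ᵥ (s ⊕ b)))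
  (meet-shift s x y)

-- A common letter gives `a ≡ t ⊕ (s ⊕ a)`, which forces equality. Thus a word never meets its
-- translate by a nonzero element.
meet-free : ∀ {d k} (s t : Vec Bool d) (y : Word d k) → meet y (shift t (shift s y)) ≡ true → t ≡ s
meet-free s t []      ()
meet-free s t (a ∷ y) eq with a ≟ᵥ (t ⊕ (s ⊕ a))
... | yes a≡ = ⊕-fixed a s t a≡
... | no  _  = meet-free s t y eq

unit : ∀ {d} → Fin d → Vec Bool d
unit i = tabulate (λ l → does (l Fin.≟ i))

true≢false : true ≢ false
true≢false ()

module _ {d k : ℕ} (m : ℕ) (P : Vec ℕ d → Word d k)
  (P-clique : ∀ {F v v′} → v ∈ᶠ F → v′ ∈ᶠ F → meet (P v) (P v′) ≡ true)
  (P-twist  : ∀ i v → P (v [ i ]≔ m) ≡ shift (unit i) (P (v [ i ]≔ 0))) where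

  perp : Face d → Word d k → Bool
  perp F w = every (λ v → meet (P v) w) F

  perp-self : ∀ {F v} → v ∈ᶠ F → perp F (P v) ≡ true
  perp-self {F} v∈F = every⁺ _ F (λ v′∈F → P-clique v′∈F v∈F)

  perp-twist : ∀ i F w → perp (F [ i ]≔ pt m) w ≡ perp (F [ i ]≔ pt 0) (shift (unit i) w)
  perp-twist i F w = every-update i
    (λ v → trans (cong (λ y → meet y w) (P-twist i v)) (meet-shift (unit i) (P (v [ i ]≔ 0)) w)) F

  -- The indicator function of the translate of F⊥ by `t`, read as a binary number so that the
  -- translates can be ordered.
  key : Face d → Vec Bool d → ℕ
  key F t = bits (List.map (λ w → perp F (shift t w)) (words d k))

  -- F⊥ contains `P v` for each vertex `v` of `F`. If two translates of F⊥ coincide, then `P v`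
  -- meets its own translate by `t ⊕ s`, and `meet-free` applies.
  key-injective : ∀ F {s t} → key F s ≡ key F t → t ≡ s
  key-injective F {s} {t} eq with vertex F
  ... | v , v∈F = meet-free s t (P v) (every⁻ _ (trans (sym same) (trans (cong (perp F) (shift-cancel s (P v)))
                                                                      (perp-self v∈F))) v∈F)
    where
    same : perp F (shift s (shift s (P v))) ≡ perp F (shift t (shift s (P v)))
    same = All.lookup (bits-injective (words d k) eq) (∈-vecs (∈-vecs ∈-bools) (shift s (P v)))

  abstract
    label : Face d → Vec Bool d
    -- The default argument of `argmin` is itself a member of `signs d`, so the minimum is over the
    -- whole group.
    label F = argmin (key F) (replicate d false) (signs d)

    label-min : ∀ F t → key F (label F) ℕ.≤ key F t
    label-min F t = All.lookup (f[argmin]≤f[xs] (replicate d false) (signs d)) (∈-vecs ∈-bools t)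

  label-unique : ∀ F s → (∀ t → key F s ℕ.≤ key F t) → label F ≡ s
  label-unique F s min = key-injective F (ℕₚ.≤-antisym (min (label F)) (label-min F s))

  label-cong : ∀ F G → (∀ w → perp F w ≡ perp G w) → label F ≡ label G
  label-cong F G eq = label-unique F (label G) (λ t → subst₂ ℕ._≤_ (key-eq (label G)) (key-eq t) (label-min G t))
    where
    key-eq : ∀ t → key G t ≡ key F t
    key-eq t = cong bits (Listₚ.map-cong (λ w → sym (eq (shift t w))) (words d k))

  -- Moving a wall from 0 to `m` translates F⊥ by `unit i`, so the translation that minimises the
  -- key changes by `unit i` as well.
  label-twist : ∀ i F → label (F [ i ]≔ pt m) ≡ unit i ⊕ label (F [ i ]≔ pt 0)
  label-twist i F = label-unique F′ (e ⊕ label F₀)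
    (λ t → subst₂ ℕ._≤_ (trans (cong (key F₀) (sym (⊕-cancelˡ e (label F₀)))) (sym (key-twist (e ⊕ label F₀))))
                        (sym (key-twist t)) (label-min F₀ (e ⊕ t)))
    where
    F′ = F [ i ]≔ pt m
    F₀ = F [ i ]≔ pt 0
    e  = unit i
    shift-⊕ : ∀ {k} t (w : Word d k) → shift e (shift t w) ≡ shift (e ⊕ t) w
    shift-⊕ t []      = refl
    shift-⊕ t (a ∷ w) = cong₂ _∷_ (sym (Vecₚ.zipWith-assoc Boolₚ.xor-assoc e t a)) (shift-⊕ t w)
    key-twist : ∀ t → key F′ t ≡ key F₀ (e ⊕ t)
    key-twist t = cong bits (Listₚ.map-cong
      (λ w → trans (perp-twist i F (shift t w)) (cong (perp F₀) (shift-⊕ t w))) (words d k))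

  -- F⊥ lies in G⊥ because `G` has fewer vertices to meet. The inclusion is strict, since the label
  -- depends on F⊥ alone.
  perp-separates : ∀ F G → G ⊑ F → label F ≢ label G → ∃ λ w → perp F w ≡ false × perp G w ≡ true
  perp-separates F G G⊑F ne with All.all? (λ w → perp F w Bool.≟ perp G w) (words d k)
  ... | yes eq = contradiction (label-cong F G (λ w → All.lookup eq (∈-vecs (∈-vecs ∈-bools) w))) ne
  ... | no ¬eq with find (Allₚ.¬All⇒Any¬ (λ w → perp F w Bool.≟ perp G w) (words d k) ¬eq)
  ...   | w , _ , ne′ with perp F w in eqF | perp G w in eqG
  ...     | false | true  = w , eqF , eqG
  ...     | false | false = contradiction refl ne′
  ...     | true  | true  = contradiction refl ne′
  ...     | true  | false = contradiction (trans (sym (every⁺ _ G (λ v∈G → every⁻ _ eqF (G⊑F v∈G)))) eqG) true≢false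

  -- Remembering that each y comes from a vertex of `F` ensures that any word of F⊥ meets all of
  -- them, which is what extending the list requires.
  SkewIn : Face d → ℕ → Set
  SkewIn F n = ∃ λ (l : List (Word d k × Word d k)) → length l ≡ n × All Avoid l × AllPairs LaterMeet l ×
               All (λ (y , _) → ∃ λ v → v ∈ᶠ F × y ≡ P v) l

  -- Descend along a flag. At each step take `w` in G⊥ but not in F⊥, and a vertex `v` of `F` whose
  -- word misses `w`; the words found inside `G` all meet `w`.
  flags⇒skew : ∀ {e} (hs : Vec (Face d → Bool) e) → replicate d true ≢ replicate d false →
               (∀ l F G → label F ≡ label G → lookup hs l F ≡ lookup hs l G) →
               ∀ F → flags hs F ≡ true → SkewIn F (suc e)
  flags⇒skew [] d≢0 _ F _ with vertex F
  -- The bottom of the flag needs one word that misses `P v`: a translate by a nonzero element,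
  -- written as a double shift to suit `meet-free`.
  ... | v , v∈F = (P v , shift ones (shift zeros (P v))) ∷ [] , refl
                , Boolₚ.¬-not (d≢0 ∘ meet-free zeros ones (P v)) ∷ [] , [] ∷ [] , (v , v∈F , refl) ∷ []
    where
    ones  = replicate d true
    zeros = replicate d false
  flags⇒skew (h ∷ hs) d≢0 respects F eq with flags-witness h hs F eq
  ... | G , G⊑F , eqG , hF≢hG with flags⇒skew hs d≢0 (respects ∘ suc) G eqG | perp-separates F G G⊑F (hF≢hG ∘ respects zero F G)
  ...   | l , len , avoid , later , inG | w , perpF , perpG with every-witness _ F perpF
  ...     | v , v∈F , av = (P v , w) ∷ l , cong suc len , av ∷ avoid
                         , All.map (λ { (_ , v′∈G , refl) → every⁻ _ perpG v′∈G }) inG ∷ later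
                         , (v , v∈F , refl) ∷ All.map (λ { (v′ , v′∈G , y≡) → v′ , G⊑F v′∈G , y≡ }) inG

  labels : Vec (Face d → Bool) d
  labels = tabulate (λ l F → lookup (label F) l)

  lookup-labels : ∀ l F → lookup labels l F ≡ lookup (label F) l
  lookup-labels l F = cong (λ f → f F) (Vecₚ.lookup∘tabulate (λ l F → lookup (label F) l) l)

  labels-twisted : Twisted m labels
  labels-twisted l i F = begin
    lookup labels l F′                    ≡⟨ lookup-labels l F′ ⟩
    lookup (label F′) l                   ≡⟨ cong (λ s → lookup s l) (label-twist i F) ⟩
    lookup (unit i ⊕ label F₀) l          ≡⟨ Vecₚ.lookup-zipWith _xor_ l (unit i) (label F₀) ⟩
    lookup (unit i) l xor lookup (label F₀) l
      ≡⟨ cong₂ _xor_ (Vecₚ.lookup∘tabulate (λ l → does (l Fin.≟ i)) l) (sym (lookup-labels l F₀)) ⟩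
    does (l Fin.≟ i) xor lookup labels l F₀ ∎
    where
    open ≡-Reasoning
    F′ = F [ i ]≔ pt m
    F₀ = F [ i ]≔ pt 0

  -- An odd total yields a cube with an odd flag count. All y come from vertices of that one cube
  -- and so meet pairwise, which gives the doubled bound.
  long-skew : replicate d true ≢ replicate d false → suc d ℕ.+ suc d ℕ.≤ 2 ^ k
  long-skew d≢0 with ∑cubes-witness m (flags labels) (∑cubes-flags m labels labels-twisted)
  ... | F , eq with flags⇒skew labels d≢0 respects F eq
    where
    respects : ∀ l F G → label F ≡ label G → lookup labels l F ≡ lookup labels l G
    respects l F G eq = trans (lookup-labels l F) (trans (cong (λ s → lookup s l) eq) (sym (lookup-labels l G)))
  ... | l , len , avoid , later , inF = subst (λ n → n ℕ.+ n ℕ.≤ 2 ^ k) len (skew-clique-length l avoid later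
    (All.map (λ { (_ , v∈F , refl) → All.map (λ { (_ , v′∈F , refl) → P-clique v∈F v′∈F }) inF }) inF))

-- Potentials on trees

injective∧≥⇒surjective : ∀ {m n} {f : Fin m → Fin n} → Injective _≡_ _≡_ f → n ℕ.≤ m → ∀ y → ∃ λ x → f x ≡ y
injective∧≥⇒surjective {n = suc n} {f} inj n≤m y with Finₚ.any? (λ x → f x Fin.≟ y)
... | yes found  = found
... | no  missed = contradiction (Finₚ.injective⇒≤ punched-injective) (ℕₚ.<⇒≱ n≤m)
  where
  y≢ : ∀ x → y ≢ f x
  y≢ x eq = missed (x , sym eq)
  punched-injective : Injective _≡_ _≡_ (λ x → punchOut (y≢ x))
  punched-injective {x} {x′} eq = inj (Finₚ.punchOut-injective (y≢ x) (y≢ x′) eq)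

xor-via : ∀ a b c → (a xor b) xor (b xor c) ≡ a xor c
xor-via a b c = trans (Boolₚ.xor-assoc a b (b xor c)) (cong (a xor_) (xor-cancelˡ b c))

coboundary-walk : ∀ {n} {E : List (Edge n)} (φ ψ : Fin n → Bool) →
  (∀ {x y w} → (x , y , w) ∈ E → φ x xor φ y ≡ ψ x xor ψ y) →
  ∀ {x y w} → Walk E x y w → φ x xor φ y ≡ ψ x xor ψ y
coboundary-walk φ ψ eq {x} stay = trans (Boolₚ.xor-same (φ x)) (sym (Boolₚ.xor-same (ψ x)))
coboundary-walk φ ψ eq (fwd {x} {y} {z} e p) = trans (sym (xor-via (φ x) (φ y) (φ z)))
  (trans (cong₂ _xor_ (eq e) (coboundary-walk φ ψ eq p)) (xor-via (ψ x) (ψ y) (ψ z)))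
coboundary-walk φ ψ eq (bwd {x} {y} {z} e p) = trans (sym (xor-via (φ x) (φ y) (φ z)))
  (trans (cong₂ _xor_ (trans (Boolₚ.xor-comm (φ x) (φ y)) (trans (eq e) (Boolₚ.xor-comm (ψ y) (ψ x))))
                      (coboundary-walk φ ψ eq p)) (xor-via (ψ x) (ψ y) (ψ z)))

funToFin-cong : ∀ {m n} {f g : Fin m → Fin n} → (∀ i → f i ≡ g i) → funToFin f ≡ funToFin g
funToFin-cong {zero}  eq = refl
funToFin-cong {suc m} eq = cong₂ combine (eq zero) (funToFin-cong (eq ∘ suc))

finToFun-injective : ∀ m {n} {c c′ : Fin (n ^ m)} → (∀ i → finToFun {n} {m} c i ≡ finToFun c′ i) → c ≡ c′
finToFun-injective m {n} {c} {c′} eq =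
  trans (sym (Finₚ.funToFin-finToFin {m} {n} c)) (trans (funToFin-cong {m} eq) (Finₚ.funToFin-finToFin {m} {n} c′))

open Inverse Finₚ.2↔Bool renaming
  ( to to toBool; from to fromBool
  ; strictlyInverseˡ to toBool-fromBool; strictlyInverseʳ to fromBool-toBool)

-- On a connected graph the coboundary is injective on potentials vanishing at the root; a tree has
-- as many edges as non-root vertices, so it is also surjective.
tree-potential : ∀ {n} (T : Tree n) (ℓ : Edge n → Bool) →
  ∃ λ (φ : Fin n → Bool) → ∀ {x y w} → (x , y , w) ∈ edges T → φ x xor φ y ≡ ℓ (x , y , w)
tree-potential {zero}  T ℓ = (λ ()) , λ { {()} }
tree-potential {suc n} T ℓ = rooted (proj₁ solution) , λ {x} {y} e∈ → begin
    rooted (proj₁ solution) x xor rooted (proj₁ solution) y ≡⟨ edge (proj₁ solution) e∈ ⟩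
    toBool (finToFun (δ (proj₁ solution)) (Any.index e∈))
      ≡⟨ cong (λ c → toBool (finToFun c (Any.index e∈))) (proj₂ solution) ⟩
    toBool (finToFun target (Any.index e∈))
      ≡⟨ cong toBool (Finₚ.finToFun-funToFin (λ i → fromBool (ℓ (List.lookup es i))) (Any.index e∈)) ⟩
    toBool (fromBool (ℓ (List.lookup es (Any.index e∈)))) ≡⟨ toBool-fromBool _ ⟩
    ℓ (List.lookup es (Any.index e∈))                     ≡⟨ cong ℓ (sym (Anyₚ.lookup-index e∈)) ⟩
    ℓ _                                                   ∎
  where
  open ≡-Reasoning
  es = edges T
  -- Potentials and edge labellings are both numbered by powers of 2, so that the pigeonhole
  -- principle applies to `δ`.
  rooted : Fin (2 ^ n) → Fin (suc n) → Bool
  rooted c zero    = false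
  rooted c (suc i) = toBool (finToFun c i)
  jump : Fin (2 ^ n) → Edge (suc n) → Bool
  jump c (x , y , _) = rooted c x xor rooted c y
  δ : Fin (2 ^ n) → Fin (2 ^ length es)
  δ c = funToFin (λ i → fromBool (jump c (List.lookup es i)))
  edge : ∀ c {x y w} (e∈ : (x , y , w) ∈ es) →
         rooted c x xor rooted c y ≡ toBool (finToFun (δ c) (Any.index e∈))
  edge c e∈ = sym (trans
    (cong toBool (Finₚ.finToFun-funToFin (λ i → fromBool (jump c (List.lookup es i))) (Any.index e∈)))
    (trans (toBool-fromBool _) (cong (jump c) (sym (Anyₚ.lookup-index e∈)))))
  δ-injective : Injective _≡_ _≡_ δ
  δ-injective {c} {c′} eq = finToFun-injective n (λ i → trans (sym (fromBool-toBool _))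
    (trans (cong fromBool (coboundary-walk (rooted c) (rooted c′)
                            (λ e∈ → trans (edge c e∈) (trans (cong (λ k → toBool (finToFun k (Any.index e∈))) eq)
                                                             (sym (edge c′ e∈))))
                            (proj₂ (Tree.connected T zero (suc i)))))
           (fromBool-toBool _)))
  target : Fin (2 ^ length es)
  target = funToFin (λ i → fromBool (ℓ (List.lookup es i)))
  solution : ∃ λ c → δ c ≡ target
  solution = injective∧≥⇒surjective δ-injective (ℕₚ.≤-reflexive (cong (2 ^_) (Tree.size T))) target

-- The torus

Side : Set
Side = Fin 4

nextSide : Side → Side
nextSide 0F = 1F
nextSide 1F = 2F
nextSide 2F = 3F
nextSide 3F = 0F

opposite : Side → Side → Bool
opposite s t = does (t Fin.≟ nextSide (nextSide s))

-- The circle is cut at the corner between sides `3F` and `0F`; for sides that are not opposite,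
-- this tells whether the short arc between them passes the cut.
crossing : Side → Side → Bool
crossing 0F 3F = true
crossing 3F 0F = true
crossing _  _  = false

crossing-self : ∀ s → crossing s s ≡ false
crossing-self = from-yes (Finₚ.all? (λ s → crossing s s Bool.≟ false))

crossing-sym : ∀ s t → crossing s t ≡ crossing t s
crossing-sym = from-yes (Finₚ.all? (λ s → Finₚ.all? (λ t → crossing s t Bool.≟ crossing t s)))

-- Pairwise non-opposite sides lie on two adjacent sides, an arc that does not close up around the
-- circle.
crossing-cocycle : ∀ r s t → opposite r s ≡ false → opposite s t ≡ false → opposite r t ≡ false →
                   crossing r s xor crossing s t ≡ crossing r t
crossing-cocycle = from-yes (Finₚ.all? (λ r → Finₚ.all? (λ s → Finₚ.all? (λ t →
  (opposite r s Bool.≟ false) →-dec (opposite s t Bool.≟ false) →-dec (opposite r t Bool.≟ false) →-dec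
  (crossing r s xor crossing s t Bool.≟ crossing r t)))))

-- A cycle of 4 (ℓ + 1) lattice points, the boundary of a square of side ℓ + 1 in the plane with the
-- maximum norm. The second component counts down the steps left before the last point of the side.
Point : ℕ → Set
Point ℓ = Side × Fin (suc ℓ)

-- The sides run counterclockwise from the corner `(0 , suc ℓ)`. Each contains its starting corner,
-- at countdown ℓ, and stops one step before the next corner.
xcoord ycoord : ∀ {ℓ} → Point ℓ → ℕ
xcoord     (0F , t) = 0
xcoord {ℓ} (1F , t) = ℓ ℕ.∸ toℕ t
xcoord {ℓ} (2F , t) = suc ℓ
xcoord     (3F , t) = suc (toℕ t)
ycoord     (0F , t) = suc (toℕ t)
ycoord     (1F , t) = 0
ycoord {ℓ} (2F , t) = ℓ ℕ.∸ toℕ t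
ycoord {ℓ} (3F , t) = suc ℓ

next : ∀ {ℓ} → Point ℓ → Point ℓ
next {ℓ} (s , zero)  = nextSide s , fromℕ ℓ
next     (s , suc t) = s , inject₁ t

chebyshev : ∀ {ℓ} → Point ℓ → Point ℓ → ℕ
chebyshev a b = ∣ xcoord a - xcoord b ∣ ⊔ ∣ ycoord a - ycoord b ∣

chebyshev-self : ∀ {ℓ} (a : Point ℓ) → chebyshev a a ≡ 0
chebyshev-self a = cong₂ _⊔_ (ℕₚ.∣n-n∣≡0 (xcoord a)) (ℕₚ.∣n-n∣≡0 (ycoord a))

chebyshev-sym : ∀ {ℓ} (a b : Point ℓ) → chebyshev a b ≡ chebyshev b a
chebyshev-sym a b = cong₂ _⊔_ (ℕₚ.∣-∣-comm (xcoord a) (xcoord b)) (ℕₚ.∣-∣-comm (ycoord a) (ycoord b))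

⊔-+-≤ : ∀ {x y} x₁ x₂ y₁ y₂ → x ℕ.≤ x₁ ℕ.+ x₂ → y ℕ.≤ y₁ ℕ.+ y₂ → x ⊔ y ℕ.≤ (x₁ ⊔ y₁) ℕ.+ (x₂ ⊔ y₂)
⊔-+-≤ x₁ x₂ y₁ y₂ p q = ℕₚ.⊔-lub
  (ℕₚ.≤-trans p (ℕₚ.+-mono-≤ (ℕₚ.m≤m⊔n x₁ y₁) (ℕₚ.m≤m⊔n x₂ y₂)))
  (ℕₚ.≤-trans q (ℕₚ.+-mono-≤ (ℕₚ.m≤n⊔m x₁ y₁) (ℕₚ.m≤n⊔m x₂ y₂)))

chebyshev-triangle : ∀ {ℓ} (a b c : Point ℓ) → chebyshev a c ℕ.≤ chebyshev a b ℕ.+ chebyshev b c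
chebyshev-triangle a b c = ⊔-+-≤ ∣ xcoord a - xcoord b ∣ ∣ xcoord b - xcoord c ∣
                                 ∣ ycoord a - ycoord b ∣ ∣ ycoord b - ycoord c ∣
                                 (ℕₚ.∣-∣-triangle (xcoord a) (xcoord b) (xcoord c))
                                 (ℕₚ.∣-∣-triangle (ycoord a) (ycoord b) (ycoord c))

opposite-far : ∀ {ℓ} (a b : Point ℓ) → chebyshev a b ℕ.≤ ℓ → opposite (proj₁ a) (proj₁ b) ≡ false
opposite-far a@(s , _) b@(t , _) close with opposite s t in eq
... | false = refl
... | true  = contradiction close (ℕₚ.<⇒≱ (far a b eq))
  where
  far : ∀ {ℓ} (a b : Point ℓ) → opposite (proj₁ a) (proj₁ b) ≡ true → ℓ ℕ.< chebyshev a b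
  far {ℓ} a@(0F , _) b@(2F , _) _ = ℕₚ.m≤m⊔n (suc ℓ) ∣ ycoord a - ycoord b ∣
  far {ℓ} a@(2F , _) b@(0F , _) _ = ℕₚ.m≤m⊔n (suc ℓ) ∣ ycoord a - ycoord b ∣
  far {ℓ} a@(1F , _) b@(3F , _) _ = ℕₚ.m≤n⊔m ∣ xcoord a - xcoord b ∣ (suc ℓ)
  far {ℓ} a@(3F , _) b@(1F , _) _ = ℕₚ.m≤n⊔m ∣ xcoord a - xcoord b ∣ (suc ℓ)

∣1+n-n∣≤1 : ∀ n → ∣ suc n - n ∣ ℕ.≤ 1
∣1+n-n∣≤1 zero    = ℕₚ.≤-refl
∣1+n-n∣≤1 (suc n) = ∣1+n-n∣≤1 n

∣n-1+n∣≤1 : ∀ n → ∣ n - suc n ∣ ℕ.≤ 1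
∣n-1+n∣≤1 n = subst (ℕ._≤ 1) (ℕₚ.∣-∣-comm (suc n) n) (∣1+n-n∣≤1 n)

∸-close : ∀ m n → ∣ m ℕ.∸ suc n - (m ℕ.∸ n) ∣ ℕ.≤ 1
∸-close zero    zero    = z≤n
∸-close zero    (suc n) = z≤n
∸-close (suc m) zero    = ∣n-1+n∣≤1 m
∸-close (suc m) (suc n) = ∸-close m n

next-close : ∀ {ℓ} (a : Point ℓ) → chebyshev a (next a) ℕ.≤ 1
next-close {ℓ} (0F , zero)  rewrite Finₚ.toℕ-fromℕ ℓ | ℕₚ.n∸n≡0 ℓ = ℕₚ.≤-refl
next-close {ℓ} (1F , zero)  rewrite Finₚ.toℕ-fromℕ ℓ | ℕₚ.n∸n≡0 ℓ = ℕₚ.⊔-lub (∣n-1+n∣≤1 ℓ) z≤n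
next-close {ℓ} (2F , zero)  rewrite Finₚ.toℕ-fromℕ ℓ | ℕₚ.∣n-n∣≡0 ℓ = ∣n-1+n∣≤1 ℓ
next-close {ℓ} (3F , zero)  rewrite Finₚ.toℕ-fromℕ ℓ | ℕₚ.∣n-n∣≡0 ℓ = ℕₚ.≤-refl
next-close {suc ℓ} (0F , suc t) rewrite Finₚ.toℕ-inject₁ t = ∣1+n-n∣≤1 (toℕ t)
next-close {suc ℓ} (1F , suc t) rewrite Finₚ.toℕ-inject₁ t = ℕₚ.⊔-lub (∸-close (suc ℓ) (toℕ t)) z≤n
next-close {suc ℓ} (2F , suc t) rewrite Finₚ.toℕ-inject₁ t | ℕₚ.∣n-n∣≡0 ℓ = ∸-close (suc ℓ) (toℕ t)
next-close {suc ℓ} (3F , suc t) rewrite Finₚ.toℕ-inject₁ t | ℕₚ.∣n-n∣≡0 ℓ =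
  ℕₚ.⊔-lub (∣1+n-n∣≤1 (toℕ t)) z≤n

Torus : ℕ → ℕ → Set
Torus ℓ = Vec (Point ℓ)

ρ : ∀ {ℓ d} → Torus ℓ d → Torus ℓ d → ℕ
ρ []      []      = 0
ρ (a ∷ u) (b ∷ v) = chebyshev a b ⊔ ρ u v

ρ-self : ∀ {ℓ d} (u : Torus ℓ d) → ρ u u ≡ 0
ρ-self []      = refl
ρ-self (a ∷ u) = cong₂ _⊔_ (chebyshev-self a) (ρ-self u)

ρ-sym : ∀ {ℓ d} (u v : Torus ℓ d) → ρ u v ≡ ρ v u
ρ-sym []      []      = refl
ρ-sym (a ∷ u) (b ∷ v) = cong₂ _⊔_ (chebyshev-sym a b) (ρ-sym u v)

ρ-triangle : ∀ {ℓ d} (u v w : Torus ℓ d) → ρ u w ℕ.≤ ρ u v ℕ.+ ρ v w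
ρ-triangle []      []      []      = z≤n
ρ-triangle (a ∷ u) (b ∷ v) (c ∷ w) =
  ⊔-+-≤ (chebyshev a b) (chebyshev b c) (ρ u v) (ρ v w) (chebyshev-triangle a b c) (ρ-triangle u v w)

chebyshev≤ρ : ∀ {ℓ d} (u v : Torus ℓ d) r → chebyshev (lookup u r) (lookup v r) ℕ.≤ ρ u v
chebyshev≤ρ (a ∷ u) (b ∷ v) zero    = ℕₚ.m≤m⊔n _ _
chebyshev≤ρ (a ∷ u) (b ∷ v) (suc r) = ℕₚ.≤-trans (chebyshev≤ρ u v r) (ℕₚ.m≤n⊔m (chebyshev a b) (ρ u v))

-- The double cover of the circle

State : ℕ → Set
State ℓ = Point ℓ × Bool

step : ∀ {ℓ} → State ℓ → State ℓ
step (a , b) = next a , b xor crossing (proj₁ a) (proj₁ (next a))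

state : ∀ ℓ → ℕ → State ℓ
state ℓ = fold ((0F , fromℕ ℓ) , false) step

orbit : ∀ ℓ → ℕ → Point ℓ
orbit ℓ = proj₁ ∘ state ℓ

winding : ℕ → ℕ → Bool
winding ℓ = proj₂ ∘ state ℓ

side-traversal : ∀ {ℓ} s b → fold {A = State ℓ} ((s , fromℕ ℓ) , b) step (suc ℓ)
                           ≡ ((nextSide s , fromℕ ℓ) , b xor crossing s (nextSide s))
side-traversal {ℓ} s b =
  -- `iterate` performs the first step first, so the induction can follow the countdown along the
  -- side.
  trans (iterate-is-fold ((s , fromℕ ℓ) , b) step (suc ℓ)) (go ℓ (fromℕ ℓ) (Finₚ.toℕ-fromℕ ℓ))
  where
  go : ∀ j (t : Fin (suc ℓ)) → toℕ t ≡ j → iterate step ((s , t) , b) (suc j)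
                                         ≡ ((nextSide s , fromℕ ℓ) , b xor crossing s (nextSide s))
  go zero    zero    eq = refl
  go (suc j) (suc t) eq rewrite crossing-self s | Boolₚ.xor-identityʳ b =
    go j (inject₁ t) (trans (Finₚ.toℕ-inject₁ t) (ℕₚ.suc-injective eq))

-- A full turn passes the cut once, on leaving side `3F`, and so returns to the starting point on
-- the other sheet.
state-period : ∀ ℓ → state ℓ (4 ℕ.* suc ℓ) ≡ ((0F , fromℕ ℓ) , true)
state-period ℓ = begin
  fold (from 0F false) step (L ℕ.+ (L ℕ.+ (L ℕ.+ (L ℕ.+ 0))))
    ≡⟨ fold-+ (from 0F false) step L ⟩
  fold (fold (from 0F false) step (L ℕ.+ (L ℕ.+ (L ℕ.+ 0)))) step L
    ≡⟨ cong (λ z → fold z step L) (fold-+ (from 0F false) step L) ⟩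
  fold (fold (fold (from 0F false) step (L ℕ.+ (L ℕ.+ 0))) step L) step L
    ≡⟨ cong (λ z → fold (fold z step L) step L) (fold-+ (from 0F false) step L) ⟩
  fold (fold (fold (fold (from 0F false) step (L ℕ.+ 0)) step L) step L) step L
    ≡⟨ cong (λ z → fold (fold (fold z step L) step L) step L) (fold-+ (from 0F false) step L) ⟩
  fold (fold (fold (fold (from 0F false) step L) step L) step L) step L
    ≡⟨ cong (λ z → fold (fold (fold z step L) step L) step L) (side-traversal 0F false) ⟩
  fold (fold (fold (from 1F false) step L) step L) step L
    ≡⟨ cong (λ z → fold (fold z step L) step L) (side-traversal 1F false) ⟩
  fold (fold (from 2F false) step L) step L
    ≡⟨ cong (λ z → fold z step L) (side-traversal 2F false) ⟩
  fold (from 3F false) step L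
    ≡⟨ side-traversal 3F false ⟩
  from 0F true ∎
  where
  open ≡-Reasoning
  L = suc ℓ
  from : Side → Bool → State ℓ
  from s b = (s , fromℕ ℓ) , b

-- Two lattice points of one cell are equal or consecutive, and `step` changes the winding exactly
-- by the crossing.
winding-crossing : ∀ ℓ {a b c} → a ∈ᶜ c → b ∈ᶜ c →
                   chebyshev (orbit ℓ a) (orbit ℓ b) ℕ.≤ 1 ×
                   winding ℓ a xor winding ℓ b ≡ crossing (proj₁ (orbit ℓ a)) (proj₁ (orbit ℓ b))
winding-crossing ℓ {a} {b} p q = go p q
  where
  same : ∀ j → chebyshev (orbit ℓ j) (orbit ℓ j) ℕ.≤ 1 ×
               winding ℓ j xor winding ℓ j ≡ crossing (proj₁ (orbit ℓ j)) (proj₁ (orbit ℓ j))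
  same j = subst (ℕ._≤ 1) (sym (chebyshev-self (orbit ℓ j))) z≤n
         , trans (Boolₚ.xor-same (winding ℓ j)) (sym (crossing-self _))
  go : ∀ {a b c} → a ∈ᶜ c → b ∈ᶜ c → chebyshev (orbit ℓ a) (orbit ℓ b) ℕ.≤ 1 ×
       winding ℓ a xor winding ℓ b ≡ crossing (proj₁ (orbit ℓ a)) (proj₁ (orbit ℓ b))
  go (at {j}) at = same j
  go (lo {j}) lo = same j
  go (hi {j}) hi = same (suc j)
  go (lo {j}) hi = next-close (orbit ℓ j) , xor-cancelˡ (winding ℓ j) _
  go (hi {j}) lo = subst (ℕ._≤ 1) (chebyshev-sym (orbit ℓ j) (orbit ℓ (suc j))) (next-close (orbit ℓ j))
                 , trans (Boolₚ.xor-comm (winding ℓ (suc j)) (winding ℓ j))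
                     (trans (xor-cancelˡ (winding ℓ j) _)
                            (crossing-sym (proj₁ (orbit ℓ j)) (proj₁ (orbit ℓ (suc j)))))

ρ-orbit : ∀ ℓ {d} {F : Face d} {u v} → u ∈ᶠ F → v ∈ᶠ F → ρ (map (orbit ℓ) u) (map (orbit ℓ) v) ℕ.≤ 1
ρ-orbit ℓ []        []        = z≤n
ρ-orbit ℓ (p ∷ u∈F) (q ∷ v∈F) = ℕₚ.⊔-lub (proj₁ (winding-crossing ℓ p q)) (ρ-orbit ℓ u∈F v∈F)

-- Placing n points on the torus

record Retract (A : Set) (n : ℕ) : Set where
  field
    place   : Fin n → A
    index   : A → Fin n
    place-index : ∀ a → place (index a) ≡ a

Fin-retract : ∀ {N n} → 0 ℕ.< N → N ℕ.≤ n → Retract (Fin N) n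
Fin-retract {suc N} {n} _ N≤n = record { place = place ; index = λ i → inject≤ i N≤n ; place-index = place-index }
  where
  place : Fin n → Fin (suc N)
  place x with toℕ x ℕ.<? suc N
  ... | yes x<N = fromℕ< x<N
  -- Surplus points are doubled up at `zero`, which exists since `N` is positive.
  ... | no  _   = zero
  place-index : ∀ i → place (inject≤ i N≤n) ≡ i
  place-index i with toℕ (inject≤ i N≤n) ℕ.<? suc N
  ... | yes i<N = trans (Finₚ.fromℕ<-cong _ _ (Finₚ.toℕ-inject≤ i N≤n) i<N (Finₚ.toℕ<n i))
                    (Finₚ.fromℕ<-toℕ i (Finₚ.toℕ<n i))
  ... | no  i≮N = contradiction (subst (ℕ._< suc N) (sym (Finₚ.toℕ-inject≤ i N≤n)) (Finₚ.toℕ<n i)) i≮N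

torus-retract : ∀ ℓ d {n} → (4 ℕ.* suc ℓ) ^ d ℕ.≤ n → Retract (Torus ℓ d) n
torus-retract ℓ d N≤n = record
  { place       = λ x → decode (place x)
  ; index       = λ u → index (encode u)
  ; place-index = λ u → trans (cong decode (place-index (encode u))) (decode-encode u)
  }
  where
  open Retract (Fin-retract (ℕₚ.m^n>0 (4 ℕ.* suc ℓ) d) N≤n)
  decode : Fin ((4 ℕ.* suc ℓ) ^ d) → Torus ℓ d
  decode i = tabulate (λ r → remQuot (suc ℓ) (finToFun {4 ℕ.* suc ℓ} {d} i r))
  encode : Torus ℓ d → Fin ((4 ℕ.* suc ℓ) ^ d)
  encode u = funToFin (λ r → uncurry combine (lookup u r))
  decode-encode : ∀ u → decode (encode u) ≡ u
  decode-encode u = trans (Vecₚ.tabulate-cong (λ r → trans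
    (cong (remQuot (suc ℓ)) (Finₚ.finToFun-funToFin (λ r → uncurry combine (lookup u r)) r))
    (Finₚ.remQuot-combine (proj₁ (lookup u r)) (proj₂ (lookup u r))))) (Vecₚ.tabulate∘lookup u)

-- The metric

-- Division normalises through a gcd, which is stuck for a variable `m`; the constructor form lets
-- order and arithmetic reduce to integers.
ℕ→ℚ-mkℚ : ∀ m → ℕ→ℚ m ≡ mkℚ (+ m) 0 (Coprimality.sym (Coprimality.1-coprimeTo m))
ℕ→ℚ-mkℚ m = ℚₚ.normalize-coprime (Coprimality.sym (Coprimality.1-coprimeTo m))

ℕ→ℚ-mono-≤ : ∀ {m n} → m ℕ.≤ n → ℕ→ℚ m ≤ ℕ→ℚ n
ℕ→ℚ-mono-≤ {m} {n} m≤n rewrite ℕ→ℚ-mkℚ m | ℕ→ℚ-mkℚ n = *≤* (ℤₚ.*-monoʳ-≤-nonNeg (+ 1) (+≤+ m≤n))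

ℕ→ℚ-mono-< : ∀ {m n} → m ℕ.< n → ℕ→ℚ m < ℕ→ℚ n
ℕ→ℚ-mono-< {m} {n} m<n rewrite ℕ→ℚ-mkℚ m | ℕ→ℚ-mkℚ n = *<* (ℤₚ.*-monoʳ-<-pos (+ 1) (+<+ m<n))

ℕ→ℚ-cancel-< : ∀ {m n} → ℕ→ℚ m < ℕ→ℚ n → m ℕ.< n
ℕ→ℚ-cancel-< {m} {n} lt with n ℕ.≤? m
... | yes n≤m = contradiction (ℚₚ.<-≤-trans lt (ℕ→ℚ-mono-≤ n≤m)) (ℚₚ.<-irrefl refl)
... | no  n≰m = ℕₚ.≰⇒> n≰m

ℕ→ℚ-+ : ∀ m n → ℕ→ℚ (m ℕ.+ n) ≡ ℕ→ℚ m + ℕ→ℚ n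
ℕ→ℚ-+ m n rewrite ℕ→ℚ-mkℚ m | ℕ→ℚ-mkℚ n =
  cong (_/ 1) (sym (cong₂ ℤ._+_ (ℤₚ.*-identityʳ (+ m)) (ℤₚ.*-identityʳ (+ n))))

ℕ→ℚ-* : ∀ m n → ℕ→ℚ (m ℕ.* n) ≡ ℕ→ℚ m * ℕ→ℚ n
ℕ→ℚ-* m n rewrite ℕ→ℚ-mkℚ m | ℕ→ℚ-mkℚ n = cong (_/ 1) (ℤₚ.pos-* m n)

ℕ→ℚ-^ : ∀ m e → ℕ→ℚ (m ^ e) ≡ ℕ→ℚ m ^ℚ e
ℕ→ℚ-^ m zero    = refl
ℕ→ℚ-^ m (suc e) = trans (ℕ→ℚ-* m (m ^ e)) (cong (ℕ→ℚ m *_) (ℕ→ℚ-^ m e))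

^ℚ-nonNeg : ∀ {q} → 0ℚ ≤ q → ∀ e → 0ℚ ≤ q ^ℚ e
^ℚ-nonNeg 0≤q zero    = ℚₚ.nonNegative⁻¹ 1ℚ
^ℚ-nonNeg {q} 0≤q (suc e) = subst (_≤ q * (q ^ℚ e)) (ℚₚ.*-zeroʳ q)
  (ℚₚ.*-monoˡ-≤-nonNeg q {{nonNegative 0≤q}} (^ℚ-nonNeg 0≤q e))

^ℚ-mono-≤ : ∀ {p q} → 0ℚ ≤ p → p ≤ q → ∀ e → p ^ℚ e ≤ q ^ℚ e
^ℚ-mono-≤ 0≤p p≤q zero    = ℚₚ.≤-refl
^ℚ-mono-≤ {p} {q} 0≤p p≤q (suc e) = ℚₚ.≤-trans
  (ℚₚ.*-monoʳ-≤-nonNeg (p ^ℚ e) {{nonNegative (^ℚ-nonNeg 0≤p e)}} p≤q)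
  (ℚₚ.*-monoˡ-≤-nonNeg q {{nonNegative (ℚₚ.≤-trans 0≤p p≤q)}} (^ℚ-mono-≤ 0≤p p≤q e))

^ℚ-distrib-* : ∀ p q e → (p * q) ^ℚ e ≡ (p ^ℚ e) * (q ^ℚ e)
^ℚ-distrib-* p q zero    = refl
^ℚ-distrib-* p q (suc e) = begin
  p * q * (p * q) ^ℚ e            ≡⟨ cong (p * q *_) (^ℚ-distrib-* p q e) ⟩
  p * q * (p ^ℚ e * q ^ℚ e)       ≡⟨ ℚₚ.*-assoc p q _ ⟩
  p * (q * (p ^ℚ e * q ^ℚ e))     ≡⟨ cong (p *_) (sym (ℚₚ.*-assoc q (p ^ℚ e) (q ^ℚ e))) ⟩
  p * (q * p ^ℚ e * q ^ℚ e)       ≡⟨ cong (λ z → p * (z * q ^ℚ e)) (ℚₚ.*-comm q (p ^ℚ e)) ⟩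
  p * (p ^ℚ e * q * q ^ℚ e)       ≡⟨ cong (p *_) (ℚₚ.*-assoc (p ^ℚ e) q (q ^ℚ e)) ⟩
  p * (p ^ℚ e * (q * q ^ℚ e))     ≡⟨ sym (ℚₚ.*-assoc p (p ^ℚ e) _) ⟩
  p * p ^ℚ e * (q * q ^ℚ e)       ∎
  where open ≡-Reasoning

apart : ∀ {n} → Fin n → Fin n → ℕ
apart x y with x Fin.≟ y
... | yes _ = 0
... | no  _ = 1

apart-self : ∀ {n} (x : Fin n) → apart x x ≡ 0
apart-self x with x Fin.≟ x
... | yes _   = refl
... | no  x≢x = contradiction refl x≢x

apart-≢ : ∀ {n} {x y : Fin n} → x ≢ y → apart x y ≡ 1
apart-≢ {x = x} {y} x≢y with x Fin.≟ y
... | yes x≡y = contradiction x≡y x≢y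
... | no  _   = refl

apart≤1 : ∀ {n} (x y : Fin n) → apart x y ℕ.≤ 1
apart≤1 x y with x Fin.≟ y
... | yes _ = z≤n
... | no  _ = s≤s z≤n

apart-sym : ∀ {n} (x y : Fin n) → apart x y ≡ apart y x
apart-sym x y with x Fin.≟ y
... | yes refl = sym (apart-self x)
... | no  x≢y  = sym (apart-≢ (x≢y ∘ sym))

apart-triangle : ∀ {n} (x y z : Fin n) → apart x z ℕ.≤ apart x y ℕ.+ apart y z
apart-triangle x y z with x Fin.≟ y
... | yes refl = ℕₚ.≤-refl
... | no  _    = ℕₚ.≤-trans (apart≤1 x z) (ℕₚ.m≤m+n 1 (apart y z))

-- A pseudometric is made positive off the diagonal, so that several points may share a place.
module _ {n : ℕ} (σ : Fin n → Fin n → ℕ) where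

  separated : Fin n → Fin n → ℕ
  separated x y = apart x y ⊔ σ x y

  separate : (∀ x → σ x x ≡ 0) → (∀ x y → σ x y ≡ σ y x) → (∀ x y z → σ x z ℕ.≤ σ x y ℕ.+ σ y z) → Metric n
  separate σ-self σ-sym σ-triangle = record
    { d      = λ x y → ℕ→ℚ (separated x y)
    ; d-self = λ x → cong ℕ→ℚ (cong₂ _⊔_ (apart-self x) (σ-self x))
    ; d-pos  = λ x y x≢y → ℕ→ℚ-mono-<
        (ℕₚ.≤-trans (ℕₚ.≤-reflexive (sym (apart-≢ x≢y))) (ℕₚ.m≤m⊔n (apart x y) (σ x y)))
    ; d-sym  = λ x y → cong ℕ→ℚ (cong₂ _⊔_ (apart-sym x y) (σ-sym x y))
    ; d-tri  = λ x y z → subst (ℕ→ℚ (separated x z) ≤_) (ℕ→ℚ-+ (separated x y) (separated y z))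
        (ℕ→ℚ-mono-≤ (⊔-+-≤ (apart x y) (apart y z) (σ x y) (σ y z) (apart-triangle x y z) (σ-triangle x y z)))
    }

-- Words from a cheap cover

meet⁺ : ∀ {d k} (x y : Word d k) i → lookup x i ≡ lookup y i → meet x y ≡ true
meet⁺ (s ∷ x) (t ∷ y) zero    eq with s ≟ᵥ t
... | yes _   = refl
... | no  s≢t = contradiction eq s≢t
meet⁺ (s ∷ x) (t ∷ y) (suc i) eq = trans (cong (does (s ≟ᵥ t) ∨_) (meet⁺ x y i eq)) (Boolₚ.∨-zeroʳ _)

⊕-tabulate : ∀ {d} (f g : Fin d → Bool) → tabulate f ⊕ tabulate g ≡ tabulate (λ r → f r xor g r)
⊕-tabulate {zero}  f g = refl
⊕-tabulate {suc d} f g = cong ((f zero xor g zero) ∷_) (⊕-tabulate (f ∘ suc) (g ∘ suc))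

xor-swap : ∀ a b c d → a xor b ≡ c xor d → c xor a ≡ d xor b
xor-swap a b c d eq = trans (sym (xor-via c d a))
  (trans (cong (_xor (d xor a)) (sym eq)) (trans (Boolₚ.xor-comm (a xor b) (d xor a)) (xor-via d a b)))

module _ {ℓ d k n : ℕ} (R : Retract (Torus ℓ d) n) (d≢0 : replicate d true ≢ replicate d false)
         (short : 2 ^ k ℕ.< suc d ℕ.+ suc d) where
  open Retract R

  side : Fin d → Fin n → Side
  side r x = proj₁ (lookup (place x) r)

  metric : Metric n
  metric = separate (λ x y → ρ (place x) (place y))
    (λ x → ρ-self (place x)) (λ x y → ρ-sym (place x) (place y)) (λ x y z → ρ-triangle (place x) (place y) (place z))

  open Metric metric using () renaming (d to dist)

  dist≥0 : ∀ x y → 0ℚ ≤ dist x y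
  dist≥0 x y = ℕ→ℚ-mono-≤ {0} {separated (λ x y → ρ (place x) (place y)) x y} z≤n

  near⇒¬opposite : ∀ r {x y} → dist x y < ℕ→ℚ (suc ℓ) → opposite (side r x) (side r y) ≡ false
  near⇒¬opposite r {x} {y} near = opposite-far (lookup (place x) r) (lookup (place y) r)
    (ℕₚ.≤-trans (chebyshev≤ρ (place x) (place y) r)
      (ℕₚ.≤-trans (ℕₚ.m≤n⊔m (apart x y) _) (ℕₚ.≤-pred (ℕ→ℚ-cancel-< near))))

  module _ {E : List (Edge n)} (dominating : ∀ {x y} w → Walk E x y w → dist x y ≤ w)
           (r : Fin d) (φ : Fin n → Bool)
           (φ-edge : ∀ {x y w} → (x , y , w) ∈ E → φ x xor φ y ≡ crossing (side r x) (side r y)) where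

    -- Domination makes the weights nonnegative and bounds all three distances below the side
    -- length. The three sides are then pairwise non-opposite and the crossings add up.
    prepend : ∀ {x y z} w v → Walk E x y (w + 0ℚ) → Walk E y z v → Walk E x z (w + v) → w + v < ℕ→ℚ (suc ℓ) →
              φ x xor φ y ≡ crossing (side r x) (side r y) →
              (v < ℕ→ℚ (suc ℓ) → φ y xor φ z ≡ crossing (side r y) (side r z)) →
              φ x xor φ z ≡ crossing (side r x) (side r z)
    prepend {x} {y} {z} w v xy yz xz w+v<L eq eqs = begin
      φ x xor φ z                    ≡⟨ sym (xor-via (φ x) (φ y) (φ z)) ⟩
      (φ x xor φ y) xor (φ y xor φ z) ≡⟨ cong₂ _xor_ eq (eqs v<L) ⟩
      crossing (side r x) (side r y) xor crossing (side r y) (side r z)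
        ≡⟨ crossing-cocycle (side r x) (side r y) (side r z)
             (near⇒¬opposite r (ℚₚ.≤-<-trans (dominating _ xy) (subst (_< ℕ→ℚ (suc ℓ)) (sym (ℚₚ.+-identityʳ w)) w<L)))
             (near⇒¬opposite r (ℚₚ.≤-<-trans (dominating _ yz) v<L))
             (near⇒¬opposite r (ℚₚ.≤-<-trans (dominating _ xz) w+v<L)) ⟩
      crossing (side r x) (side r z) ∎
      where
      open ≡-Reasoning
      0≤v : 0ℚ ≤ v
      0≤v = ℚₚ.≤-trans (dist≥0 y z) (dominating _ yz)
      0≤w : 0ℚ ≤ w
      0≤w = subst (0ℚ ≤_) (ℚₚ.+-identityʳ w) (ℚₚ.≤-trans (dist≥0 x y) (dominating _ xy))
      w<L : w < ℕ→ℚ (suc ℓ)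
      w<L = ℚₚ.≤-<-trans (subst (_≤ w + v) (ℚₚ.+-identityʳ w) (ℚₚ.+-monoʳ-≤ w 0≤v)) w+v<L
      v<L : v < ℕ→ℚ (suc ℓ)
      v<L = ℚₚ.≤-<-trans (subst (_≤ w + v) (ℚₚ.+-identityˡ v) (ℚₚ.+-monoˡ-≤ v 0≤w)) w+v<L

    -- Every tail of a walk this light is itself light, so the walk cannot wind around the circle
    -- and its total crossing depends only on its ends.
    walk-crossing : ∀ {x y w} → Walk E x y w → w < ℕ→ℚ (suc ℓ) → φ x xor φ y ≡ crossing (side r x) (side r y)
    walk-crossing {x} stay _ = trans (Boolₚ.xor-same (φ x)) (sym (crossing-self (side r x)))
    walk-crossing (fwd {w = w} {v} e p) lt = prepend w v (fwd e stay) p (fwd e p) lt (φ-edge e) (walk-crossing p)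
    walk-crossing (bwd {x} {y} {w = w} {v} e p) lt = prepend w v (bwd e stay) p (bwd e p) lt
      (trans (Boolₚ.xor-comm (φ x) (φ y)) (trans (φ-edge e) (crossing-sym (side r y) (side r x)))) (walk-crossing p)

  module _ {α : ℚ} {Ts : Fin k → Tree n} (cover : IsTreeCover metric α Ts) (α<L : α < ℕ→ℚ (suc ℓ)) where

    potential : (i : Fin k) (r : Fin d) → ∃ λ (φ : Fin n → Bool) →
                ∀ {x y w} → (x , y , w) ∈ edges (Ts i) → φ x xor φ y ≡ crossing (side r x) (side r y)
    potential i r = tree-potential (Ts i) (λ (x , y , _) → crossing (side r x) (side r y))

    position : Vec ℕ d → Fin n
    position v = index (map (orbit ℓ) v)

    -- Adding the potential of tree `i` trivialises the r-th double cover along that tree: the value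
    -- is constant along lifts of its short walks.
    sheet : Vec ℕ d → Fin k → Fin d → Bool
    sheet v i r = winding ℓ (lookup v r) xor proj₁ (potential i r) (position v)

    word : Vec ℕ d → Word d k
    word v = tabulate (λ i → tabulate (sheet v i))

    side-position : ∀ v r → side r (position v) ≡ proj₁ (orbit ℓ (lookup v r))
    side-position v r = cong proj₁ (trans (cong (λ u → lookup u r) (place-index (map (orbit ℓ) v)))
                                          (Vecₚ.lookup-map r (orbit ℓ) v))

    close : ∀ {F u v} → u ∈ᶠ F → v ∈ᶠ F → α * dist (position u) (position v) < ℕ→ℚ (suc ℓ)
    close {F} {u} {v} u∈F v∈F = ℚₚ.≤-<-trans
      (subst (α * dist (position u) (position v) ≤_) (ℚₚ.*-identityʳ α)
        (ℚₚ.*-monoˡ-≤-nonNeg α {{nonNegative (ℚₚ.≤-trans (ℚₚ.nonNegative⁻¹ 1ℚ) (proj₁ cover))}}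
          (ℕ→ℚ-mono-≤ (ℕₚ.⊔-lub (apart≤1 (position u) (position v))
            (subst₂ (λ p q → ρ p q ℕ.≤ 1) (sym (place-index _)) (sym (place-index _)) (ρ-orbit ℓ u∈F v∈F))))))
      α<L

    -- Along the short walk the potential changes by the crossing, and within a cube the winding
    -- does too; the two changes cancel.
    same-sheet : ∀ {F u v} → u ∈ᶠ F → v ∈ᶠ F → ∀ i {w} → Walk (edges (Ts i)) (position u) (position v) w →
                 w ≤ α * dist (position u) (position v) → ∀ r → sheet u i r ≡ sheet v i r
    same-sheet {u = u} {v} u∈F v∈F i walk w≤ r =
      xor-swap (φ (position u)) (φ (position v)) (winding ℓ (lookup u r)) (winding ℓ (lookup v r)) (begin
        φ (position u) xor φ (position v)
          ≡⟨ walk-crossing (λ {x} {y} → proj₁ (proj₂ cover) i x y) r φ (proj₂ (potential i r)) walk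
               (ℚₚ.≤-<-trans w≤ (close u∈F v∈F)) ⟩
        crossing (side r (position u)) (side r (position v))
          ≡⟨ cong₂ crossing (side-position u r) (side-position v r) ⟩
        crossing (proj₁ (orbit ℓ (lookup u r))) (proj₁ (orbit ℓ (lookup v r)))
          ≡⟨ sym (proj₂ (winding-crossing ℓ (Pointwise.lookup u∈F r) (Pointwise.lookup v∈F r))) ⟩
        winding ℓ (lookup u r) xor winding ℓ (lookup v r) ∎)
      where
      open ≡-Reasoning
      φ = proj₁ (potential i r)

    word-clique : ∀ {F u v} → u ∈ᶠ F → v ∈ᶠ F → meet (word u) (word v) ≡ true
    word-clique {u = u} {v} u∈F v∈F = meet-on (proj₂ (proj₂ cover) (position u) (position v))
      where
      meet-on : (∃ λ i → distT≤ (Ts i) (position u) (position v) (α * dist (position u) (position v))) →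
                meet (word u) (word v) ≡ true
      meet-on (i , _ , walk , w≤) = meet⁺ (word u) (word v) i
        (trans (Vecₚ.lookup∘tabulate (tabulate ∘ sheet u) i)
          (trans (Vecₚ.tabulate-cong (same-sheet u∈F v∈F i walk w≤))
                 (sym (Vecₚ.lookup∘tabulate (tabulate ∘ sheet v) i))))

    period : ℕ
    period = 4 ℕ.* suc ℓ

    position-period : ∀ j v → position (v [ j ]≔ period) ≡ position (v [ j ]≔ 0)
    position-period j v = cong index (trans (Vecₚ.map-[]≔ (orbit ℓ) v j)
      (trans (cong (map (orbit ℓ) v [ j ]≔_) (cong proj₁ (state-period ℓ))) (sym (Vecₚ.map-[]≔ (orbit ℓ) v j))))

    winding-period : ∀ j (v : Vec ℕ d) r → winding ℓ (lookup (v [ j ]≔ period) r)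
                                         ≡ does (r Fin.≟ j) xor winding ℓ (lookup (v [ j ]≔ 0) r)
    winding-period j v r with r Fin.≟ j
    ... | yes refl = trans (cong (winding ℓ) (Vecₚ.lookup∘updateAt r v))
                       (trans (cong proj₂ (state-period ℓ)) (cong (true xor_) (sym (cong (winding ℓ) (Vecₚ.lookup∘updateAt r v)))))
    ... | no  r≢j  = cong (winding ℓ) (trans (Vecₚ.lookup∘update′ r≢j v period) (sym (Vecₚ.lookup∘update′ r≢j v 0)))

    -- A full turn along axis `j` restores the position, hence all potentials, and flips only the
    -- winding in coordinate `j`.
    word-twist : ∀ j v → word (v [ j ]≔ period) ≡ shift (unit j) (word (v [ j ]≔ 0))
    word-twist j v = trans (Vecₚ.tabulate-cong (λ i → trans (Vecₚ.tabulate-cong (sheet-twist i))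
        (sym (⊕-tabulate (λ r → does (r Fin.≟ j)) (sheet (v [ j ]≔ 0) i)))))
      (Vecₚ.tabulate-∘ (unit j ⊕_) (tabulate ∘ sheet (v [ j ]≔ 0)))
      where
      sheet-twist : ∀ i r → sheet (v [ j ]≔ period) i r ≡ does (r Fin.≟ j) xor sheet (v [ j ]≔ 0) i r
      sheet-twist i r = trans (cong₂ _xor_ (winding-period j v r) (cong (proj₁ (potential i r)) (position-period j v)))
                              (Boolₚ.xor-assoc (does (r Fin.≟ j)) _ _)

    no-cheap-cover : suc d ℕ.+ suc d ℕ.≤ 2 ^ k
    no-cheap-cover = long-skew period word word-clique word-twist d≢0

  cover⇒stretch : ∀ α (Ts : Fin k → Tree n) → IsTreeCover metric α Ts → ℕ→ℚ (suc ℓ) ≤ α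
  cover⇒stretch α Ts cover = ℚₚ.≮⇒≥ (λ α<L → ℕₚ.<⇒≱ short (no-cheap-cover {α} {Ts} cover α<L))

-- The scale of the torus

threshold : (f : ℕ → ℕ) (n b : ℕ) → f 0 ℕ.≤ n → n ℕ.< f b → ∃ λ L → f L ℕ.≤ n × n ℕ.< f (suc L)
threshold f n zero    f0≤n n<fb = contradiction f0≤n (ℕₚ.<⇒≱ n<fb)
threshold f n (suc b) f0≤n n<fb with f b ℕ.≤? n
... | yes fb≤n = b , fb≤n , n<fb
... | no  fb≰n = threshold f n b f0≤n (ℕₚ.≰⇒> fb≰n)

scale : ∀ D n → .{{ℕ.NonZero D}} → ∃ λ L → (4 ℕ.* L) ^ D ℕ.≤ n × n ℕ.< (4 ℕ.* suc L) ^ D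
-- The search runs downwards from `suc n`, which is large enough because the exponent is positive.
scale (suc D) n = threshold (λ L → (4 ℕ.* L) ^ suc D) n (suc n) z≤n
  (ℕₚ.≤-trans (ℕₚ.m≤n*m (suc n) 4) (ℕₚ.m≤m*n (4 ℕ.* suc n) ((4 ℕ.* suc n) ^ D) {{ℕₚ.m^n≢0 (4 ℕ.* suc n) D}}))

⅛ : ℚ
⅛ = + 1 / 8

⅛*-≤ : ∀ {m M α} → m ℕ.≤ 8 ℕ.* M → ℕ→ℚ M ≤ α → ⅛ * ℕ→ℚ m ≤ α
⅛*-≤ {m} {M} {α} m≤8M M≤α = begin
  ⅛ * ℕ→ℚ m             ≤⟨ ℚₚ.*-monoˡ-≤-nonNeg ⅛ (ℕ→ℚ-mono-≤ m≤8M) ⟩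
  ⅛ * ℕ→ℚ (8 ℕ.* M)     ≡⟨ cong (⅛ *_) (ℕ→ℚ-* 8 M) ⟩
  ⅛ * (ℕ→ℚ 8 * ℕ→ℚ M)   ≡⟨ sym (ℚₚ.*-assoc ⅛ (ℕ→ℚ 8) (ℕ→ℚ M)) ⟩
  1ℚ * ℕ→ℚ M            ≡⟨ ℚₚ.*-identityˡ (ℕ→ℚ M) ⟩
  ℕ→ℚ M                 ≤⟨ M≤α ⟩
  α                     ∎
  where open ℚₚ.≤-Reasoning

⅛^-bound : ∀ {m n α} D → n ℕ.≤ m ^ D → ⅛ * ℕ→ℚ m ≤ α → (⅛ ^ℚ D) * ℕ→ℚ n ≤ α ^ℚ D
⅛^-bound {m} {n} {α} D n≤ ⅛m≤α = begin
  (⅛ ^ℚ D) * ℕ→ℚ n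
    ≤⟨ ℚₚ.*-monoˡ-≤-nonNeg (⅛ ^ℚ D) {{nonNegative (^ℚ-nonNeg (ℚₚ.nonNegative⁻¹ ⅛) D)}}
         (ℕ→ℚ-mono-≤ n≤) ⟩
  (⅛ ^ℚ D) * ℕ→ℚ (m ^ D)    ≡⟨ cong ((⅛ ^ℚ D) *_) (ℕ→ℚ-^ m D) ⟩
  (⅛ ^ℚ D) * (ℕ→ℚ m ^ℚ D)   ≡⟨ sym (^ℚ-distrib-* ⅛ (ℕ→ℚ m) D) ⟩
  (⅛ * ℕ→ℚ m) ^ℚ D
    ≤⟨ ^ℚ-mono-≤ (subst (_≤ ⅛ * ℕ→ℚ m) (ℚₚ.*-zeroʳ ⅛) (ℚₚ.*-monoˡ-≤-nonNeg ⅛ (ℕ→ℚ-mono-≤ {0} {m} z≤n)))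
         ⅛m≤α D ⟩
  α ^ℚ D                    ∎
  where open ℚₚ.≤-Reasoning

replicate-injective : ∀ d → .{{ℕ.NonZero d}} → replicate d true ≢ replicate d false
replicate-injective (suc d) ()

theorem1 : (k : ℕ) → k ≥ 1 →
    Σ ℚ (λ c → 0ℚ < c ×
    ((n : ℕ) → n ≥ 1 →
    Σ (Metric n) (λ M →
    (α : ℚ) (Ts : Fin k → Tree n) → IsTreeCover M α Ts →
    (c ^ℚ (2 ^ (k ∸ 1))) * ℕ→ℚ n ≤ α ^ℚ (2 ^ (k ∸ 1)))))
-- With n < (4(L+1))^D, the value 1/8 comes from 4(L+1) ≤ 8L for L ≥ 1, together with α ≥ L.
theorem1 (suc k) _ = ⅛ , ℚₚ.positive⁻¹ ⅛ , λ n _ → bound n (scale D n {{D≢0}})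
  where
  D = 2 ^ k
  D≢0 : ℕ.NonZero D
  D≢0 = ℕₚ.m^n≢0 2 k
  bound : ∀ n → (∃ λ L → (4 ℕ.* L) ^ D ℕ.≤ n × n ℕ.< (4 ℕ.* suc L) ^ D) →
          Σ (Metric n) λ M → (α : ℚ) (Ts : Fin (suc k) → Tree n) → IsTreeCover M α Ts →
          (⅛ ^ℚ D) * ℕ→ℚ n ≤ α ^ℚ D
  -- Here n < 4^D is too small for a torus; the discrete metric and α ≥ 1 suffice.
  bound n (zero  , _  , n<) = separate (λ _ _ → 0) (λ _ → refl) (λ _ _ → refl) (λ _ _ _ → z≤n)
    , λ α Ts cover → ⅛^-bound D (ℕₚ.<⇒≤ n<) (⅛*-≤ {4} {1} (ℕₚ.m≤n*m 4 2) (proj₁ cover))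
  bound n (suc ℓ , ≤n , n<) = metric {k = suc k} R d≢0 short
    , λ α Ts cover → ⅛^-bound D (ℕₚ.<⇒≤ n<) 
        (⅛*-≤ {4 ℕ.* suc (suc ℓ)} {suc ℓ} 4L+4≤8L (cover⇒stretch {k = suc k} R d≢0 short α Ts cover))
    where
    R = torus-retract ℓ D ≤n
    d≢0 = replicate-injective D {{D≢0}}
    -- This fixes the dimension: D + 1 exceeds half of `2 ^ suc k`, the largest length a skew clique
    -- can have.
    short : 2 ^ suc k ℕ.< suc D ℕ.+ suc D
    short = s≤s (ℕₚ.+-monoʳ-≤ D (ℕₚ.≤-trans (ℕₚ.≤-reflexive (ℕₚ.+-identityʳ D)) (ℕₚ.n≤1+n D)))
    4L+4≤8L : 4 ℕ.* suc (suc ℓ) ℕ.≤ 8 ℕ.* suc ℓ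
    4L+4≤8L = ℕₚ.≤-trans (ℕₚ.*-monoʳ-≤ 4 (s≤s (ℕₚ.m≤n+m (suc ℓ) ℓ)))
      (ℕₚ.≤-reflexive (trans (cong (4 ℕ.*_) (lemma ℓ)) (sym (ℕₚ.*-assoc 4 2 (suc ℓ)))))
      where
      lemma : ∀ ℓ → suc (ℓ ℕ.+ suc ℓ) ≡ 2 ℕ.* suc ℓ
      lemma ℓ = cong suc (cong (ℓ ℕ.+_) (sym (ℕₚ.+-identityʳ (suc ℓ))))
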